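{- Let $G$ be a connected multigraph with at least one cycle and at least two vertices, and let $t$ be a positive integer. If there is an edge set $F_0\subseteq E(G)$ satisfying $|E(G)|-|F_0|<t\cdot\tau(F_0)$, then $ar_{bc}(G,t)=|E(G)|$. Otherwise, $$ar_{bc}(G,t)=\max_{F\colon \tau(F)\geq 2}\{|F|+t\,(\tau(F)-1)\},$$ where the maximum is taken over all edge sets $F\subseteq E(G)$ with $\tau(F)\geq 2$.
   Context: For $F\subseteq E(G)$, $\tau(F)$ is the number of connected components of the spanning subgraph $(V(G),F)$ that are trees (isolated vertices count as trees). A unicyclic subgraph here means a spanning subgraph of $G$ (on all of $V(G)$) each of whose connected components contains exactly one cycle; these are exactly the bases of the bicircular matroid of $G$, whose independent sets are the edge sets in which every component has at most one cycle. Given a coloring of $E(G)$, a subgraph is rainbow if its edges have pairwise distinct colors. $ar_{bc}(G,t)$ is the maximum number $m$ such that there is a coloring of $E(G)$ with exactly $m$ colors containing no $t$ pairwise edge-disjoint rainbow unicyclic subgraphs. -}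

module Defs where

open import Data.Nat using (ℕ; zero; suc; _+_; _*_; _∸_; _≤_; _<_)
open import Data.Nat.DivMod using (_%_; m%n<n)
open import Data.Fin using (Fin; toℕ; fromℕ<) renaming (zero to fzero)
open import Data.Fin.Subset using (Subset; _∈_; ⊤; ∣_∣)
open import Data.Product using (Σ; ∃; _×_; _,_)
open import Data.Sum using (_⊎_)
open import Data.Empty using (⊥)
open import Relation.Nullary using (¬_)
open import Relation.Binary.PropositionalEquality using (_≡_; _≢_)
open import Function.Definitions using (Injective; Surjective)

record Multigraph : Set where
  field
    n : ℕ
    m : ℕ
    ends : Fin m → Fin n × Fin n
open Multigraph public

ESet : Multigraph → Set
ESet G = Subset (m G)

Joins : (G : Multigraph) → Fin (m G) → Fin (n G) → Fin (n G) → Set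
Joins G e u v = (ends G e ≡ (u , v)) ⊎ (ends G e ≡ (v , u))

data Reach (G : Multigraph) (F : ESet G) : Fin (n G) → Fin (n G) → Set where
  here : ∀ {u} → Reach G F u u
  step : ∀ {u w v} (e : Fin (m G)) → e ∈ F → Joins G e u w → Reach G F w v → Reach G F u v

Connected : Multigraph → Set
Connected G = ∀ u v → Reach G ⊤ u v

cnext : ∀ {j} → Fin (suc j) → Fin (suc j)
cnext {j} i = fromℕ< (m%n<n (suc (toℕ i)) (suc j))

-- A cycle in (V(G),F): distinct vertices v_0..v_j and distinct edges e_0..e_j of F,
-- e_i joining v_i and v_{i+1 mod (j+1)} (length 1 = loop, length 2 = two parallel edges).
record Cycle (G : Multigraph) (F : ESet G) : Set where
  field
    len  : ℕ
    vs   : Fin (suc len) → Fin (n G)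
    es   : Fin (suc len) → Fin (m G)
    vs-inj : Injective _≡_ _≡_ vs
    es-inj : Injective _≡_ _≡_ es
    es-in  : ∀ i → es i ∈ F
    es-join : ∀ i → Joins G (es i) (vs i) (vs (cnext i))
open Cycle public

-- the cycle lies in the component of v (cycles are connected)
CycleAt : (G : Multigraph) (F : ESet G) → Fin (n G) → Cycle G F → Set
CycleAt G F v c = Reach G F v (vs c fzero)

SameCycle : (G : Multigraph) (F : ESet G) → Cycle G F → Cycle G F → Set
SameCycle G F c c' = ∀ e → ((∃ λ i → es c i ≡ e) → (∃ λ i → es c' i ≡ e))
                         × ((∃ λ i → es c' i ≡ e) → (∃ λ i → es c i ≡ e))

-- the component of v in (V(G),F) is a tree (connected by definition; acyclic)
TreeComp : (G : Multigraph) (F : ESet G) → Fin (n G) → Set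
TreeComp G F v = ¬ (Σ (Cycle G F) λ c → CycleAt G F v c)

-- τ(F) = k : the tree components of (V(G),F) are exactly k many
-- (k pairwise non-reachable representatives, each of a tree component,
--  covering every vertex lying in a tree component)
Tau : (G : Multigraph) → ESet G → ℕ → Set
Tau G F k = Σ (Fin k → Fin (n G)) λ r →
    (∀ i → TreeComp G F (r i))
  × (∀ i j → i ≢ j → ¬ Reach G F (r i) (r j))
  × (∀ v → TreeComp G F v → ∃ λ i → Reach G F (r i) v)

Unicyclic : (G : Multigraph) → ESet G → Set
Unicyclic G F = ∀ v → Σ (Cycle G F) λ c → CycleAt G F v c
                  × (∀ c' → CycleAt G F v c' → SameCycle G F c c')

Rainbow : (G : Multigraph) {k : ℕ} → (Fin (m G) → Fin k) → ESet G → Set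
Rainbow G col F = ∀ e e' → e ∈ F → e' ∈ F → col e ≡ col e' → e ≡ e'

Disjoint : (G : Multigraph) → ESet G → ESet G → Set
Disjoint G A B = ∀ e → e ∈ A → e ∈ B → ⊥

GoodColoringCount : Multigraph → ℕ → ℕ → Set
GoodColoringCount G t k = Σ (Fin (m G) → Fin k) λ col →
    Surjective _≡_ _≡_ col
  × ¬ (Σ (Fin t → ESet G) λ Fs →
         (∀ i → Unicyclic G (Fs i) × Rainbow G col (Fs i))
       × (∀ i j → i ≢ j → Disjoint G (Fs i) (Fs j)))

IsArBC : Multigraph → ℕ → ℕ → Set
IsArBC G t x = GoodColoringCount G t x × (∀ y → GoodColoringCount G t y → y ≤ x)

IsMaxFormula : Multigraph → ℕ → ℕ → Set
IsMaxFormula G t x =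
    (Σ (ESet G) λ F → ∃ λ k → Tau G F k × 2 ≤ k × x ≡ ∣ F ∣ + t * (k ∸ 1))
  × (∀ F k → Tau G F k → 2 ≤ k → ∣ F ∣ + t * (k ∸ 1) ≤ x)

HasDeficientSet : Multigraph → ℕ → Set
HasDeficientSet G t = Σ (ESet G) λ F → ∃ λ k → Tau G F k × m G < ∣ F ∣ + t * k

{-# OPTIONS --safe #-}

-- A set of edges is a base of the bicircular matroid iff it consists of n distinct edges, one
-- chosen at each vertex and incident with it; hence t disjoint bases amount to a matching of t
-- copies ("slots") of every vertex into the edges. If F has k tree components, then following
-- the chosen edges from a tree component must leave F, so every base has at least k edges
-- outside F. This gives both lower bounds: all edges get different colours, or, in the second
-- case, all edges outside some Z ⊇ F with |F| + t (k − 1) − 1 elements share one colour.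
-- For the upper bound, edges avoiding a vertex set W leave the vertices of W isolated, so
-- the hypotheses become Hall conditions: the slots can be matched into the edges, and all but
-- t − 1 of them into different colours. Augmenting paths keep matched edges matched, so there is
-- a perfect matching of the slots with at most t − 1 repetitions of colours. If one base has two
-- edges of the same colour, some other base shares no colour with it, and exchanging the edges
-- of the two bases at one vertex removes the conflict.

module Submission where

open import Defs
open import Data.Empty using (⊥; ⊥-elim)
open import Data.Fin using (Fin; zero; suc; toℕ; _↑ˡ_; _↑ʳ_; splitAt; join; combine; remQuot; punchIn)
open import Data.Fin.Permutation.Components using (transpose; transpose-inverse)
open import Data.Fin.Properties using (_≟_; any?; all?; suc-injective; injective⇒≤; toℕ-fromℕ<; toℕ<n; toℕ-injective; combine-remQuot; remQuot-combine; combine-injective; combine-injectiveʳ; splitAt-join; join-splitAt; splitAt⁻¹-↑ˡ; splitAt⁻¹-↑ʳ; splitAt-↑ˡ; splitAt-↑ʳ; ↑ˡ-injective)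
open import Data.Fin.Subset as Subset using (Subset; Nonempty; _∈_; _∉_; _⊆_; ⊤; ⁅_⁆; _∪_; _-_; ∣_∣; inside; outside)
open import Data.Fin.Subset.Properties
open import Data.List using (List; []; _∷_; allFin)
open import Data.List.Membership.Propositional using () renaming (_∈_ to _∈ˡ_)
open import Data.List.Membership.Propositional.Properties using (∈-allFin)
open import Data.List.Relation.Unary.Any using (here; there)
open import Data.Maybe using (Maybe; just; nothing)
open import Data.Maybe.Properties using (just-injective; ≡-dec)
open import Data.Nat using (ℕ; zero; suc; _+_; _*_; _∸_; _≤_; _<_; z≤n; s≤s)
open import Data.Nat.DivMod using (_%_; m%n<n; m<n⇒m%n≡m; n%n≡0; m%n%n≡m%n; [m+n]%n≡m%n; %-distribˡ-+)
open import Data.Nat.Properties as ℕ using (≤-refl; ≤-trans; <-≤-trans; ≤-<-trans; <⇒≤)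
open import Data.Product using (Σ; ∃; _×_; _,_; proj₁; proj₂)
open import Data.Product.Properties using (,-injective) renaming (≡-dec to ×-≡-dec)
open import Data.Sum using (_⊎_; inj₁; inj₂; [_,_]′)
open import Data.Vec using (Vec; []; _∷_; _++_; concat; map; replicate; tabulate; lookup; here; there)
open import Data.Vec.Properties using ([]=⇒lookup; lookup⇒[]=; lookup∘tabulate; lookup-++ˡ; lookup-++ʳ; lookup-concat; lookup-map; lookup-replicate)
open import Function using (_∘_; id; case_of_)
open import Relation.Binary.PropositionalEquality using (_≡_; _≢_; refl; sym; trans; cong; cong₂; subst; subst₂)
open import Relation.Nullary using (¬_; Dec; yes; no; does; contradiction)
open import Relation.Nullary.Decidable using (dec-true; dec-false; _×-dec_; _⊎-dec_; _→-dec_; ¬?; map′; decidable-stable)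
open import Relation.Unary using (Decidable)

private variable
  a b : ℕ

-- Finite subsets

select : {P : Fin a → Set} → Decidable P → Subset a
select P? = tabulate (does ∘ P?)

∈-select⁺ : {P : Fin a → Set} (P? : Decidable P) {x : Fin a} → P x → x ∈ select P?
∈-select⁺ P? {x} px = lookup⇒[]= x _ (trans (lookup∘tabulate _ x) (dec-true (P? x) px))

∈-select⁻ : {P : Fin a → Set} (P? : Decidable P) {x : Fin a} → x ∈ select P? → P x
∈-select⁻ P? {x} x∈ with P? x in eq
... | yes px = px
... | no  _  = contradiction
  (trans (sym ([]=⇒lookup x∈)) (trans (lookup∘tabulate _ x) (cong does eq))) λ ()

-- A relation instead of a function lets partners be chosen for members of `P` only; each chosen
-- partner is deleted from `Q` before the next choice.
∣∣-inj-≤ : (P : Subset a) (Q : Subset b) (R : Fin a → Fin b → Set) →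
  (∀ {x} → x ∈ P → ∃ λ y → y ∈ Q × R x y) →
  (∀ {x x' y} → R x y → R x' y → x ≡ x') → ∣ P ∣ ≤ ∣ Q ∣
∣∣-inj-≤ [] Q R total inj = z≤n
∣∣-inj-≤ (outside ∷ P) Q R total inj =
  ∣∣-inj-≤ P Q (R ∘ suc) (total ∘ there) (λ r r' → suc-injective (inj r r'))
∣∣-inj-≤ (inside ∷ P) Q R total inj with total here
... | y , y∈Q , r = <-≤-trans (s≤s rest) (x∈p⇒∣p-x∣<∣p∣ y∈Q)
  where
  total' : ∀ {x} → x ∈ P → ∃ λ z → z ∈ Q - y × R (suc x) z
  total' x∈P with total (there x∈P)
  ... | z , z∈Q , r' = z , x∈p∧x≢y⇒x∈p-y z∈Q (λ { refl → case inj r r' of λ () }) , r'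
  rest : ∣ P ∣ ≤ ∣ Q - y ∣
  rest = ∣∣-inj-≤ P (Q - y) (R ∘ suc) total' (λ s s' → suc-injective (inj s s'))

∣++∣ : (P : Subset a) (Q : Subset b) → ∣ P ++ Q ∣ ≡ ∣ P ∣ + ∣ Q ∣
∣++∣ [] Q = refl
∣++∣ (inside ∷ P) Q = cong suc (∣++∣ P Q)
∣++∣ (outside ∷ P) Q = ∣++∣ P Q

∣∣<-∪ : (P Q : Subset a) {x : Fin a} → x ∈ Q → x ∉ P → ∣ P ∣ < ∣ P ∪ Q ∣
∣∣<-∪ P Q {x} x∈Q x∉P = p⊂q⇒∣p∣<∣q∣ ((λ z → p⊆p∪q Q z) , x , q⊆p∪q P Q x∈Q , x∉P)

-- A subset can grow at most `a` times, so `suc a` units of fuel suffice. The searches for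
-- augmenting paths, components, systems and clean slots are instances.
saturate : (P : Subset a → Set) {Q : Set} →
  (∀ D → P D → Q ⊎ ∃ λ D' → ∣ D ∣ < ∣ D' ∣ × P D') → ∀ D → P D → Q
saturate {a} P {Q} next D₀ p₀ = go (suc a) D₀ (ℕ.m≤m+n (suc a) _) p₀
  where
  go : ∀ fuel D → a < fuel + ∣ D ∣ → P D → Q
  go zero D a<D p = contradiction (∣p∣≤n D) (ℕ.<⇒≱ a<D)
  go (suc fuel) D a< p with next D p
  ... | inj₁ q = q
  ... | inj₂ (D' , D<D' , p') =
    go fuel D' (≤-trans (subst (suc a ≤_) (sym (ℕ.+-suc fuel ∣ D ∣)) a<) (ℕ.+-monoʳ-≤ fuel D<D')) p'

SumMember : Subset a → Subset b → Fin a ⊎ Fin b → Set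
SumMember P Q = [ (_∈ P) , (_∈ Q) ]′

∣∣-inj-⊎ : ∀ {c d} (P : Subset a) (P' : Subset b) (Q : Subset c) (Q' : Subset d)
  (R : Fin a ⊎ Fin b → Fin c ⊎ Fin d → Set) →
  (∀ x → SumMember P P' x → ∃ λ y → SumMember Q Q' y × R x y) →
  (∀ x x' y → R x y → R x' y → x ≡ x') → ∣ P ∣ + ∣ P' ∣ ≤ ∣ Q ∣ + ∣ Q' ∣
∣∣-inj-⊎ {a} {b} {c} {d} P P' Q Q' R total inj = subst₂ _≤_ (∣++∣ P P') (∣++∣ Q Q')
  (∣∣-inj-≤ (P ++ P') (Q ++ Q') (λ x y → R (splitAt a x) (splitAt c y))
    (λ {x} x∈ → let y , y∈ , r = total (splitAt a x) (∈-++⁻ P P' x x∈) in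
      join c d y , ∈-++⁺ Q Q' y y∈ , subst (R (splitAt a x)) (sym (splitAt-join c d y)) r)
    (λ {x} {x'} r r' → trans (sym (join-splitAt a b x))
      (trans (cong (join a b) (inj _ _ _ r r')) (join-splitAt a b x'))))
  where
  ∈-++⁺ : ∀ {a b} (P : Subset a) (Q : Subset b) y → SumMember P Q y → join a b y ∈ P ++ Q
  ∈-++⁺ P Q (inj₁ x) x∈ = lookup⇒[]= _ _ (trans (lookup-++ˡ P Q x) ([]=⇒lookup x∈))
  ∈-++⁺ P Q (inj₂ y) y∈ = lookup⇒[]= _ _ (trans (lookup-++ʳ P Q y) ([]=⇒lookup y∈))
  ∈-++⁻ : ∀ {a b} (P : Subset a) (Q : Subset b) x → x ∈ P ++ Q → SumMember P Q (splitAt a x)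
  ∈-++⁻ {a} P Q x x∈ with splitAt a x in eq
  ... | inj₁ z = lookup⇒[]= z P (trans (sym (lookup-++ˡ P Q z))
    ([]=⇒lookup (subst (_∈ P ++ Q) (sym (splitAt⁻¹-↑ˡ eq)) x∈)))
  ... | inj₂ z = lookup⇒[]= z Q (trans (sym (lookup-++ʳ P Q z))
    ([]=⇒lookup (subst (_∈ P ++ Q) (sym (splitAt⁻¹-↑ʳ {a} eq)) x∈)))

cover-≤ : (Q : Subset a) (Q' : Subset b) (f : Fin b → Fin a) →
  (∀ x → x ∈ Q ⊎ ∃ λ e → e ∈ Q' × f e ≡ x) → a ≤ ∣ Q ∣ + ∣ Q' ∣
cover-≤ {a} {b} Q Q' f covered = subst (_≤ ∣ Q ∣ + ∣ Q' ∣) (trans (ℕ.+-identityʳ _) (∣⊤∣≡n a))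
  (∣∣-inj-⊎ (⊤ {a}) [] Q Q' R total R-inj)
  where
  R : Fin a ⊎ Fin 0 → Fin a ⊎ Fin b → Set
  R (inj₁ x) (inj₁ y) = x ≡ y
  R (inj₁ x) (inj₂ e) = f e ≡ x
  total : ∀ x → SumMember ⊤ [] x → ∃ λ y → SumMember Q Q' y × R x y
  total (inj₁ x) _ = [ (λ x∈Q → inj₁ x , x∈Q , refl) , (λ { (e , e∈Q' , eq) → inj₂ e , e∈Q' , eq }) ]′ (covered x)
  R-inj : ∀ x x' y → R x y → R x' y → x ≡ x'
  R-inj (inj₁ _) (inj₁ _) (inj₁ _) p q = cong inj₁ (trans p (sym q))
  R-inj (inj₁ _) (inj₁ _) (inj₂ _) p q = cong inj₁ (trans (sym p) q)

cylinder : Subset a → ∀ t → Subset (a * t)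
cylinder W t = concat (map (replicate t) W)

∣cylinder∣ : (W : Subset a) (t : ℕ) → ∣ cylinder W t ∣ ≡ ∣ W ∣ * t
∣cylinder∣ [] t = refl
∣cylinder∣ (inside ∷ W) t = trans (∣++∣ (replicate t inside) _) (cong₂ _+_ (∣⊤∣≡n t) (∣cylinder∣ W t))
∣cylinder∣ (outside ∷ W) t = trans (∣++∣ (replicate t outside) _) (cong₂ _+_ (∣⊥∣≡0 t) (∣cylinder∣ W t))

∈-cylinder : (W : Subset a) {t : ℕ} {v : Fin a} {i : Fin t} → v ∈ W → combine v i ∈ cylinder W t
∈-cylinder W {t} {v} {i} v∈W = lookup⇒[]= _ _ (trans (lookup-concat (map (replicate t) W) v i)
  (trans (cong (λ xs → lookup xs i) (lookup-map v (replicate t) W))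
    (trans (lookup-replicate i (lookup W v)) ([]=⇒lookup v∈W))))

superset-of-size : (F : Subset a) (k : ℕ) → ∣ F ∣ + k ≤ a → ∃ λ Z → F ⊆ Z × ∣ Z ∣ ≡ ∣ F ∣ + k
superset-of-size [] zero _ = [] , id , refl
superset-of-size (inside ∷ F) k (s≤s le) =
  let Z , F⊆Z , eq = superset-of-size F k le in inside ∷ Z , s⊆s F⊆Z , cong suc eq
superset-of-size (outside ∷ F) zero le = outside ∷ F , id , sym (ℕ.+-identityʳ _)
superset-of-size {suc a} (outside ∷ F) (suc k) le =
  let Z , F⊆Z , eq = superset-of-size F k (ℕ.≤-pred (subst (_≤ suc a) (ℕ.+-suc ∣ F ∣ k) le))
  in inside ∷ Z , out⊆ F⊆Z , trans (cong suc eq) (sym (ℕ.+-suc ∣ F ∣ k))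

argmax : (v : Subset a → ℕ) → ∃ λ F → ∀ F' → v F' ≤ v F
argmax {zero} v = [] , λ { [] → ≤-refl }
argmax {suc a} v with argmax (v ∘ (inside ∷_)) | argmax (v ∘ (outside ∷_))
... | F , max | F' , max' with ℕ.≤-total (v (inside ∷ F)) (v (outside ∷ F'))
... | inj₁ le = outside ∷ F' , λ { (inside ∷ H) → ≤-trans (max H) le ; (outside ∷ H) → max' H }
... | inj₂ ge = inside ∷ F , λ { (inside ∷ H) → max H ; (outside ∷ H) → ≤-trans (max' H) ge }

-- The colouring for the lower bound: everything outside `Z` shares the colour zero, each member of
-- `Z` gets a colour of its own. `punchIn (suc zero)` fixes zero and frees colour one for the new
-- member.
singleOut : (Z : Subset a) → Fin a → Fin (suc ∣ Z ∣)
singleOut (inside ∷ Z) zero = suc zero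
singleOut (inside ∷ Z) (suc x) = punchIn (suc zero) (singleOut Z x)
singleOut (outside ∷ Z) zero = zero
singleOut (outside ∷ Z) (suc x) = singleOut Z x

singleOut-∉ : (Z : Subset a) {x : Fin a} → x ∉ Z → singleOut Z x ≡ zero
singleOut-∉ (inside ∷ Z) {zero} x∉ = contradiction here x∉
singleOut-∉ (inside ∷ Z) {suc x} x∉ = cong (punchIn (suc zero)) (singleOut-∉ Z (x∉ ∘ there))
singleOut-∉ (outside ∷ Z) {zero} x∉ = refl
singleOut-∉ (outside ∷ Z) {suc x} x∉ = singleOut-∉ Z (x∉ ∘ there)

singleOut-onto : (Z : Subset a) (c : Fin ∣ Z ∣) → ∃ λ x → singleOut Z x ≡ suc c
singleOut-onto (inside ∷ Z) zero = zero , refl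
singleOut-onto (inside ∷ Z) (suc c) =
  let x , eq = singleOut-onto Z c in suc x , cong (punchIn (suc zero)) eq
singleOut-onto (outside ∷ Z) c = let x , eq = singleOut-onto Z c in suc x , eq

∣∣<⇒∃∉ : (Z : Subset a) → ∣ Z ∣ < a → ∃ λ x → x ∉ Z
∣∣<⇒∃∉ {a} Z lt with any? (λ x → ¬? (x ∈? Z))
... | yes found = found
... | no none = contradiction
  (subst (_≤ ∣ Z ∣) (∣⊤∣≡n a) (p⊆q⇒∣p∣≤∣q∣ {p = ⊤} λ {x} _ → decidable-stable (x ∈? Z) λ x∉ → none (x , x∉)))
  (ℕ.<⇒≱ lt)

-- Hall's theorem

_[_↦_] : {A : Set} → (Fin a → A) → Fin a → A → Fin a → A
(f [ x ↦ v ]) y with y ≟ x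
... | yes _ = v
... | no  _ = f y

[↦]-same : {A : Set} (f : Fin a → A) (x : Fin a) {v : A} → (f [ x ↦ v ]) x ≡ v
[↦]-same f x with x ≟ x
... | yes _ = refl
... | no ¬p = contradiction refl ¬p

[↦]-other : {A : Set} (f : Fin a → A) (x : Fin a) {v : A} {y : Fin a} → y ≢ x → (f [ x ↦ v ]) y ≡ f y
[↦]-other f x {y = y} y≢x with y ≟ x
... | yes p = contradiction p y≢x
... | no _ = refl

module Hall {s e : ℕ} (A : Fin s → Fin e → Set) (A? : ∀ x r → Dec (A x r)) where

  -- `I` is exactly the set of matched right-hand elements. Keeping it in the type shows that
  -- augmenting only adds to it.
  record Matching (I : Subset e) : Set where
    field
      mate : Fin s → Maybe (Fin e)
      mate-inj : ∀ {x y r} → mate x ≡ just r → mate y ≡ just r → x ≡ y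
      mate-adj : ∀ {x r} → mate x ≡ just r → A x r
      mate-onto : ∀ {r} → r ∈ I → ∃ λ x → mate x ≡ just r
      mate-into : ∀ {x r} → mate x ≡ just r → r ∈ I
  open Matching

  -- `N` may be any set containing the neighbours of `T`, so neighbourhoods need not be computed. A
  -- nonempty `T` provides an element whose neighbours can be counted in `colours-hall`.
  HallCondition : Set
  HallCondition = ∀ T N → Nonempty T → (∀ {x r} → x ∈ T → A x r → r ∈ N) → ∣ T ∣ ≤ ∣ N ∣

  match-free : ∀ {I} (M : Matching I) {x r} → mate M x ≡ nothing → A x r → r ∉ I → Matching (I ∪ ⁅ r ⁆)
  match-free {I} M {x} {r} x-free axr r∉I = record
    { mate = mate' ; mate-inj = inj ; mate-adj = adj ; mate-onto = onto ; mate-into = λ {z} → into {z} }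
    where
    mate' = mate M [ x ↦ just r ]
    cases : ∀ y {q} → mate' y ≡ just q → (y ≡ x × q ≡ r) ⊎ (mate M y ≡ just q)
    cases y eq with y ≟ x
    ... | yes p = inj₁ (p , sym (just-injective eq))
    ... | no _  = inj₂ eq
    inj : ∀ {y z q} → mate' y ≡ just q → mate' z ≡ just q → y ≡ z
    inj {y} {z} p q with cases y p | cases z q
    ... | inj₁ (refl , refl) | inj₁ (refl , _) = refl
    ... | inj₁ (refl , refl) | inj₂ q' = contradiction (mate-into M q') r∉I
    ... | inj₂ p' | inj₁ (refl , refl) = contradiction (mate-into M p') r∉I
    ... | inj₂ p' | inj₂ q' = mate-inj M p' q'
    adj : ∀ {y q} → mate' y ≡ just q → A y q
    adj {y} p with cases y p
    ... | inj₁ (refl , refl) = axr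
    ... | inj₂ p' = mate-adj M p'
    onto : ∀ {q} → q ∈ I ∪ ⁅ r ⁆ → ∃ λ y → mate' y ≡ just q
    onto {q} q∈ with x∈p∪q⁻ I ⁅ r ⁆ q∈
    ... | inj₂ q∈r with x∈⁅y⁆⇒x≡y r q∈r
    ... | refl = x , [↦]-same (mate M) x
    onto {q} q∈ | inj₁ q∈I with mate-onto M q∈I
    ... | y , eq = y , trans ([↦]-other (mate M) x λ { refl → case trans (sym x-free) eq of λ () }) eq
    into : ∀ {y q} → mate' y ≡ just q → q ∈ I ∪ ⁅ r ⁆
    into {y} p with cases y p
    ... | inj₁ (_ , refl) = q⊆p∪q I ⁅ r ⁆ (x∈⁅x⁆ r)
    ... | inj₂ p' = p⊆p∪q ⁅ r ⁆ (mate-into M p')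

  -- One step along an alternating path: `x` takes `r` over from `y`, so the hole moves from `x` to
  -- `y` while the same set `I` stays matched.
  rematch : ∀ {I} (M : Matching I) {x y r} → mate M x ≡ nothing → A x r → mate M y ≡ just r → x ≢ y →
    Σ (Matching I) λ M' → mate M' y ≡ nothing × (∀ {z} → z ≢ x → z ≢ y → mate M' z ≡ mate M z)
  rematch {I} M {x} {y} {r} x-free axr y↦r x≢y = record
    { mate = mate' ; mate-inj = inj ; mate-adj = adj ; mate-onto = onto ; mate-into = λ {z} → into {z} }
    , trans ([↦]-other f x (x≢y ∘ sym)) ([↦]-same (mate M) y)
    , λ z≢x z≢y → trans ([↦]-other f x z≢x) ([↦]-other (mate M) y z≢y)
    where
    f = mate M [ y ↦ nothing ]
    mate' = f [ x ↦ just r ]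
    cases : ∀ z {q} → mate' z ≡ just q → (z ≡ x × q ≡ r) ⊎ (z ≢ y × mate M z ≡ just q)
    cases z eq with z ≟ x
    ... | yes p = inj₁ (p , sym (just-injective eq))
    ... | no _ with z ≟ y
    ... | no z≢y = inj₂ (z≢y , eq)
    inj : ∀ {u z q} → mate' u ≡ just q → mate' z ≡ just q → u ≡ z
    inj {u} {z} p q with cases u p | cases z q
    ... | inj₁ (refl , refl) | inj₁ (refl , _) = refl
    ... | inj₁ (refl , refl) | inj₂ (z≢y , q') = contradiction (mate-inj M q' y↦r) z≢y
    ... | inj₂ (u≢y , p') | inj₁ (refl , refl) = contradiction (mate-inj M p' y↦r) u≢y
    ... | inj₂ (_ , p') | inj₂ (_ , q') = mate-inj M p' q'
    adj : ∀ {z q} → mate' z ≡ just q → A z q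
    adj {z} p with cases z p
    ... | inj₁ (refl , refl) = axr
    ... | inj₂ (_ , p') = mate-adj M p'
    onto : ∀ {q} → q ∈ I → ∃ λ z → mate' z ≡ just q
    onto {q} q∈ with mate-onto M q∈
    ... | z , eq with z ≟ y
    ... | yes refl = x , trans ([↦]-same f x) (trans (sym y↦r) eq)
    ... | no z≢y = z , trans ([↦]-other f x {y = z} λ { refl → case trans (sym x-free) eq of λ () })
                             (trans ([↦]-other (mate M) y {y = z} z≢y) eq)
    into : ∀ {z q} → mate' z ≡ just q → q ∈ I
    into {z} p with cases z p
    ... | inj₁ (_ , refl) = mate-into M y↦r
    ... | inj₂ (_ , p') = mate-into M p'

  -- T collects the ends of alternating paths from x₀; since every rerouted matching still
  -- agrees with M outside T, the search can be continued from any of them.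
  augment : HallCondition → ∀ {I} (M : Matching I) {x₀} → mate M x₀ ≡ nothing →
    ∃ λ r → r ∉ I × Matching (I ∪ ⁅ r ⁆)
  augment hall {I} M {x₀} x₀-free = saturate P next ⁅ x₀ ⁆ start
    where
    P : Subset s → Set
    P T = x₀ ∈ T × (∀ {x} → x ∈ T →
      Σ (Matching I) λ M' → mate M' x ≡ nothing × (∀ {z} → z ∉ T → mate M' z ≡ mate M z))
    start : P ⁅ x₀ ⁆
    start = x∈⁅x⁆ x₀ , λ x∈ → M , trans (cong (mate M) (x∈⁅y⁆⇒x≡y x₀ x∈)) x₀-free , λ _ → refl
    _↦?_ : ∀ y r → Dec (mate M y ≡ just r)
    y ↦? r = ≡-dec _≟_ (mate M y) (just r)
    next : ∀ T → P T → (∃ λ r → r ∉ I × Matching (I ∪ ⁅ r ⁆)) ⊎ ∃ λ T' → ∣ T ∣ < ∣ T' ∣ × P T'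
    next T (x₀∈T , holes) with any? (λ x → any? λ r → (x ∈? T) ×-dec A? x r ×-dec ¬? (r ∈? I))
    ... | yes (x , r , x∈T , axr , r∉I) =
      let M' , x-free , _ = holes x∈T in inj₁ (r , r∉I , match-free M' x-free axr r∉I)
    ... | no ¬free with any? (λ x → any? λ r → any? λ y → (x ∈? T) ×-dec A? x r ×-dec ¬? (y ∈? T) ×-dec (y ↦? r))
    ... | yes (x , r , y , x∈T , axr , y∉T , y↦r) with holes x∈T
    ... | M' , x-free , agree with rematch M' x-free axr (trans (agree y∉T) y↦r) (λ { refl → y∉T x∈T })
    ... | M'' , y-free , agree' = inj₂ (T ∪ ⁅ y ⁆ , ∣∣<-∪ T ⁅ y ⁆ (x∈⁅x⁆ y) y∉T , p⊆p∪q ⁅ y ⁆ x₀∈T , holes')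
      where
      holes' : ∀ {z} → z ∈ T ∪ ⁅ y ⁆ →
        Σ (Matching I) λ M' → mate M' z ≡ nothing × (∀ {w} → w ∉ T ∪ ⁅ y ⁆ → mate M' w ≡ mate M w)
      holes' z∈ with x∈p∪q⁻ T ⁅ y ⁆ z∈
      ... | inj₁ z∈T = let N , z-free , agr = holes z∈T in N , z-free , λ w∉ → agr (w∉ ∘ p⊆p∪q ⁅ y ⁆)
      ... | inj₂ z∈y with x∈⁅y⁆⇒x≡y y z∈y
      ... | refl = M'' , y-free , λ w∉ → trans
        (agree' (λ { refl → w∉ (p⊆p∪q ⁅ y ⁆ x∈T) }) (λ { refl → w∉ (q⊆p∪q T ⁅ y ⁆ (x∈⁅x⁆ y)) }))
        (agree (w∉ ∘ p⊆p∪q ⁅ y ⁆))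
    -- The search is stuck: all neighbours of `T` are mates under `M` of members of `T`. As `x₀` has
    -- no mate, `N` is too small for Hall's condition.
    next T (x₀∈T , holes) | no ¬free | no ¬grow =
      contradiction (hall T N (x₀ , x₀∈T) nbr) (ℕ.<⇒≱ (≤-<-trans N≤ (x∈p⇒∣p-x∣<∣p∣ x₀∈T)))
      where
      Hit? = λ r → any? λ y → (y ∈? T) ×-dec (y ↦? r)
      N = select Hit?
      nbr : ∀ {x r} → x ∈ T → A x r → r ∈ N
      nbr {x} {r} x∈T axr with r ∈? I
      ... | no r∉I = contradiction (x , r , x∈T , axr , r∉I) ¬free
      ... | yes r∈I with mate-onto M r∈I
      ... | y , y↦r with y ∈? T
      ... | yes y∈T = ∈-select⁺ Hit? (y , y∈T , y↦r)
      ... | no y∉T = contradiction (x , r , y , x∈T , axr , y∉T , y↦r) ¬grow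
      N≤ : ∣ N ∣ ≤ ∣ T - x₀ ∣
      N≤ = ∣∣-inj-≤ N (T - x₀) (λ r y → mate M y ≡ just r)
        (λ r∈N → let y , y∈T , y↦r = ∈-select⁻ Hit? r∈N in
          y , x∈p∧x≢y⇒x∈p-y y∈T (λ { refl → case trans (sym x₀-free) y↦r of λ () }) , y↦r)
        (λ p q → just-injective (trans (sym p) q))

  PerfectMatching⊇ : Subset e → Set
  PerfectMatching⊇ I = Σ (Fin s → Fin e) λ φ →
    (∀ {x y} → φ x ≡ φ y → x ≡ y) × (∀ x → A x (φ x)) × (∀ {r} → r ∈ I → ∃ λ x → φ x ≡ r)

  -- Each augmentation keeps the matched right-hand elements matched, though perhaps with other
  -- partners, so `I` stays covered until no left-hand element is free.
  extend-matching : HallCondition → ∀ {I} → Matching I → PerfectMatching⊇ I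
  extend-matching hall {I} M₀ = saturate (λ J → I ⊆ J × Matching J) next I (id , M₀)
    where
    total : ∀ {J} (M : Matching J) → I ⊆ J → (∀ x → ∃ λ r → mate M x ≡ just r) → PerfectMatching⊇ I
    total M I⊆J def = (proj₁ ∘ def)
      , (λ {x} {y} eq → mate-inj M (proj₂ (def x)) (trans (proj₂ (def y)) (cong just (sym eq))))
      , (λ x → mate-adj M (proj₂ (def x)))
      , λ r∈I → let x , x↦r = mate-onto M (I⊆J r∈I) in x , just-injective (trans (sym (proj₂ (def x))) x↦r)
    next : ∀ J → I ⊆ J × Matching J → PerfectMatching⊇ I ⊎ ∃ λ J' → ∣ J ∣ < ∣ J' ∣ × I ⊆ J' × Matching J'
    next J (I⊆J , M) with any? (λ x → ≡-dec _≟_ (mate M x) nothing)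
    ... | yes (x₀ , x₀-free) = let r , r∉J , M' = augment hall M x₀-free in
      inj₂ (J ∪ ⁅ r ⁆ , ∣∣<-∪ J ⁅ r ⁆ (x∈⁅x⁆ r) r∉J , p⊆p∪q ⁅ r ⁆ ∘ I⊆J , M')
    ... | no ¬free = inj₁ (total M I⊆J def)
      where
      def : ∀ x → ∃ λ r → mate M x ≡ just r
      def x with mate M x in eq
      ... | just r = r , refl
      ... | nothing = contradiction (x , eq) ¬free

-- Connectivity, cycles and τ

anyVec? : ∀ k {P : Vec (Fin b) k → Set} → Decidable P → Dec (∃ P)
anyVec? zero P? = map′ (λ p → [] , p) (λ { ([] , p) → p }) (P? [])
anyVec? (suc k) P? = map′ (λ { (x , xs , p) → x ∷ xs , p }) (λ { (x ∷ xs , p) → x , xs , p })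
  (any? λ x → anyVec? k (P? ∘ (x ∷_)))

toℕ-cnext : ∀ {j} (i : Fin (suc j)) → toℕ (cnext i) ≡ suc (toℕ i) % suc j
toℕ-cnext {j} i = toℕ-fromℕ< (m%n<n (suc (toℕ i)) (suc j))

advance : ∀ {j} → ℕ → Fin (suc j) → Fin (suc j)
advance zero i = i
advance (suc k) i = cnext (advance k i)

toℕ-advance : ∀ {j} k (i : Fin (suc j)) → toℕ (advance k i) ≡ (k + toℕ i) % suc j
toℕ-advance {j} zero i = sym (m<n⇒m%n≡m (toℕ<n i))
toℕ-advance {j} (suc k) i = trans (toℕ-cnext (advance k i))
  (trans (cong (λ x → suc x % suc j) (toℕ-advance k i)) (sym (suc-% (k + toℕ i))))
  where
  suc-% : ∀ x → suc x % suc j ≡ suc (x % suc j) % suc j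
  suc-% x = trans (%-distribˡ-+ 1 x (suc j)) (sym (trans (%-distribˡ-+ 1 (x % suc j) (suc j))
    (cong (λ z → (1 % suc j + z) % suc j) (m%n%n≡m%n x (suc j)))))

advance-to : ∀ {j} (x y : Fin (suc j)) → ∃ λ k → advance k x ≡ y
advance-to {j} x y = k , toℕ-injective (trans (toℕ-advance k x) (trans (cong (_% suc j) total)
  (trans ([m+n]%n≡m%n (toℕ y) (suc j)) (m<n⇒m%n≡m (toℕ<n y)))))
  where
  -- `suc j ∸ toℕ x` steps lead from `x` round to zero, and `toℕ y` more lead to `y`.
  k = toℕ y + (suc j ∸ toℕ x)
  total : k + toℕ x ≡ toℕ y + suc j
  total = trans (ℕ.+-assoc (toℕ y) _ _) (cong (toℕ y +_) (ℕ.m∸n+n≡m (<⇒≤ (toℕ<n x))))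

cnext-surjective : ∀ {j} (y : Fin (suc j)) → ∃ λ x → cnext x ≡ y
cnext-surjective y with advance-to (cnext y) y
... | zero , eq = y , eq
... | suc k , eq = advance k (cnext y) , eq

module Graph (G : Multigraph) where

  Vertex Edge : Set
  Vertex = Fin (n G)
  Edge = Fin (m G)

  Inc : Edge → Vertex → Set
  Inc e v = ∃ λ w → Joins G e v w

  HasCycleAt : ESet G → Vertex → Set
  HasCycleAt F v = Σ (Cycle G F) (CycleAt G F v)

  joins? : ∀ e u v → Dec (Joins G e u v)
  joins? e u v = ×-≡-dec _≟_ _≟_ (ends G e) (u , v) ⊎-dec ×-≡-dec _≟_ _≟_ (ends G e) (v , u)

  inc? : ∀ e v → Dec (Inc e v)
  inc? e v = any? (joins? e v)

  joins-sym : ∀ {e u v} → Joins G e u v → Joins G e v u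
  joins-sym = [ inj₂ , inj₁ ]′

  joins-unique : ∀ {e u v u' v'} → Joins G e u v → Joins G e u' v' →
    (u ≡ u' × v ≡ v') ⊎ (u ≡ v' × v ≡ u')
  joins-unique p q with p | q
  ... | inj₁ p | inj₁ q = inj₁ (,-injective (trans (sym p) q))
  ... | inj₁ p | inj₂ q = inj₂ (,-injective (trans (sym p) q))
  ... | inj₂ p | inj₁ q = let x , y = ,-injective (trans (sym p) q) in inj₂ (y , x)
  ... | inj₂ p | inj₂ q = let x , y = ,-injective (trans (sym p) q) in inj₁ (y , x)

  reach-trans : ∀ {F u v w} → Reach G F u v → Reach G F v w → Reach G F u w
  reach-trans here q = q
  reach-trans (step e e∈F j p) q = step e e∈F j (reach-trans p q)

  reach-sym : ∀ {F u v} → Reach G F u v → Reach G F v u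
  reach-sym here = here
  reach-sym (step e e∈F j p) = reach-trans (reach-sym p) (step e e∈F (joins-sym j) here)

  crossing-edge : ∀ {F u v} {P : Vertex → Set} → Decidable P → Reach G F u v → P u → ¬ P v →
    ∃ λ x → ∃ λ y → ∃ λ e → e ∈ F × Joins G e x y × P x × ¬ P y
  crossing-edge P? here pu ¬pv = contradiction pu ¬pv
  crossing-edge P? (step {u} {w} e e∈F j p) pu ¬pv with P? w
  ... | yes pw = crossing-edge P? p pw ¬pv
  ... | no ¬pw = u , w , e , e∈F , j , pu , ¬pw

  -- A set is grown from `u` along `F` until no edge crosses its boundary; by `crossing-edge`
  -- nothing outside it is then reachable.
  reach? : ∀ F u v → Dec (Reach G F u v)
  reach? F u = saturate P next ⁅ u ⁆ (x∈⁅x⁆ u , λ v∈ → subst (Reach G F u) (sym (x∈⁅y⁆⇒x≡y u v∈)) here)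
    where
    P : Subset (n G) → Set
    P D = u ∈ D × (∀ {v} → v ∈ D → Reach G F u v)
    next : ∀ D → P D → (∀ v → Dec (Reach G F u v)) ⊎ ∃ λ D' → ∣ D ∣ < ∣ D' ∣ × P D'
    next D (u∈D , reached) with any? (λ x → any? λ y → any? λ e →
      (e ∈? F) ×-dec joins? e x y ×-dec (x ∈? D) ×-dec ¬? (y ∈? D))
    ... | yes (x , y , e , e∈F , j , x∈D , y∉D) =
      inj₂ (D ∪ ⁅ y ⁆ , ∣∣<-∪ D ⁅ y ⁆ (x∈⁅x⁆ y) y∉D , p⊆p∪q ⁅ y ⁆ u∈D , λ v∈ → reached' (x∈p∪q⁻ D ⁅ y ⁆ v∈))
      where
      reached' : ∀ {v} → v ∈ D ⊎ v ∈ ⁅ y ⁆ → Reach G F u v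
      reached' (inj₁ v∈D) = reached v∈D
      reached' (inj₂ v∈y) = subst (Reach G F u) (sym (x∈⁅y⁆⇒x≡y y v∈y))
        (reach-trans (reached x∈D) (step e e∈F j here))
    ... | no ¬cross = inj₁ decide
      where
      decide : ∀ v → Dec (Reach G F u v)
      decide v with v ∈? D
      ... | yes v∈D = yes (reached v∈D)
      ... | no v∉D = no λ p → ¬cross (crossing-edge (_∈? D) p u∈D v∉D)

  -- The vertices of a cycle are distinct, which bounds its length by `n G`; vectors replace the
  -- functions in `Cycle` so that the search is finite.
  cycleAt? : ∀ F v → Dec (HasCycleAt F v)
  cycleAt? F v = map′ to from
    (ℕ.anyUpTo? (λ ℓ → anyVec? (suc ℓ) λ xs → anyVec? (suc ℓ) λ ys → coded? ℓ xs ys) (n G))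
    where
    Coded : ∀ ℓ → Vec Vertex (suc ℓ) → Vec Edge (suc ℓ) → Set
    Coded ℓ xs ys = (∀ i j → lookup xs i ≡ lookup xs j → i ≡ j)
      × (∀ i j → lookup ys i ≡ lookup ys j → i ≡ j)
      × (∀ i → lookup ys i ∈ F)
      × (∀ i → Joins G (lookup ys i) (lookup xs i) (lookup xs (cnext i)))
      × Reach G F v (lookup xs zero)
    coded? : ∀ ℓ xs ys → Dec (Coded ℓ xs ys)
    coded? ℓ xs ys = all? (λ i → all? λ j → (lookup xs i ≟ lookup xs j) →-dec (i ≟ j))
      ×-dec all? (λ i → all? λ j → (lookup ys i ≟ lookup ys j) →-dec (i ≟ j))
      ×-dec all? (λ i → lookup ys i ∈? F)
      ×-dec all? (λ i → joins? (lookup ys i) (lookup xs i) (lookup xs (cnext i)))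
      ×-dec reach? F v (lookup xs zero)
    to : _ → HasCycleAt F v
    to (ℓ , _ , xs , ys , xs-inj , ys-inj , ys∈F , ys-join , reach) = record
      { len = ℓ ; vs = lookup xs ; es = lookup ys ; vs-inj = xs-inj _ _ ; es-inj = ys-inj _ _
      ; es-in = ys∈F ; es-join = ys-join } , reach
    from : HasCycleAt F v → _
    from (c , reach) = len c , injective⇒≤ (vs-inj c) , tabulate (vs c) , tabulate (es c)
      , (λ i j eq → vs-inj c (trans (sym (xs i)) (trans eq (xs j))))
      , (λ i j eq → es-inj c (trans (sym (ys i)) (trans eq (ys j))))
      , (λ i → subst (_∈ F) (sym (ys i)) (es-in c i))
      , (λ i → subst₂ (λ x y → Joins G (lookup (tabulate (es c)) i) x y) (sym (xs i)) (sym (xs (cnext i)))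
               (subst (λ e → Joins G e (vs c i) (vs c (cnext i))) (sym (ys i)) (es-join c i)))
      , subst (Reach G F v) (sym (xs zero)) reach
      where
      xs = lookup∘tabulate (vs c)
      ys = lookup∘tabulate (es c)

  -- Reachability and the presence of a cycle are decidable, so representatives can be collected
  -- greedily along the list of all vertices.
  τ : ∀ F → ∃ (Tau G F)
  τ F = let k , r , tree , apart , cover = representatives (allFin (n G)) in
    k , r , tree , apart , λ v → cover v (∈-allFin v)
    where
    representatives : (l : List Vertex) → ∃ λ k → Σ (Fin k → Vertex) λ r →
      (∀ i → TreeComp G F (r i)) × (∀ i j → i ≢ j → ¬ Reach G F (r i) (r j))
      × (∀ v → v ∈ˡ l → TreeComp G F v → ∃ λ i → Reach G F (r i) v)
    representatives [] = 0 , (λ ()) , (λ ()) , (λ ()) , λ _ ()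
    representatives (u ∷ l) with representatives l
    ... | k , r , tree , apart , cover with ¬? (cycleAt? F u) | any? (λ i → reach? F (r i) u)
    ... | no ¬tree-u | _ = k , r , tree , apart , λ
      { v (here refl) tv → contradiction tv ¬tree-u ; v (there v∈) tv → cover v v∈ tv }
    ... | yes _ | yes p = k , r , tree , apart , λ
      { v (here refl) tv → p ; v (there v∈) tv → cover v v∈ tv }
    ... | yes tree-u | no ¬p = suc k , r' , tree' , apart' , cover'
      where
      r' : Fin (suc k) → Vertex
      r' zero = u
      r' (suc i) = r i
      tree' : ∀ i → TreeComp G F (r' i)
      tree' zero = tree-u
      tree' (suc i) = tree i
      apart' : ∀ i j → i ≢ j → ¬ Reach G F (r' i) (r' j)
      apart' zero zero i≢j _ = i≢j refl
      apart' zero (suc j) _ p = ¬p (j , reach-sym p)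
      apart' (suc i) zero _ p = ¬p (i , p)
      apart' (suc i) (suc j) i≢j = apart i j (i≢j ∘ cong suc)
      cover' : ∀ v → v ∈ˡ u ∷ l → TreeComp G F v → ∃ λ i → Reach G F (r' i) v
      cover' v (here refl) tv = zero , here
      cover' v (there v∈) tv = let i , p = cover v v∈ tv in suc i , p

  -- Each representative of the first family goes to one of the second family in its component; two
  -- with the same target would be connected. Used in both directions, this makes the value of τ
  -- unique.
  tau-≤ : ∀ {F k k'} → Tau G F k → Tau G F k' → k ≤ k'
  tau-≤ (r , tree , apart , _) (r' , _ , _ , cover') = injective⇒≤ {f = λ i → proj₁ (cov i)}
    λ {i} {j} eq → decidable-stable (i ≟ j) λ i≢j → apart i j i≢j
      (reach-trans (reach-sym (proj₂ (cov i)))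
        (subst (λ h → Reach G _ (r' h) (r j)) (sym eq) (proj₂ (cov j))))
    where
    cov = λ i → cover' (r i) (tree i)

  meets? : ∀ W e → Dec (∃ λ v → v ∈ W × Inc e v)
  meets? W e = any? λ v → (v ∈? W) ×-dec inc? e v

  avoiding : Subset (n G) → ESet G
  avoiding W = select (¬? ∘ meets? W)

  avoiding-isolates : ∀ W {w v} → w ∈ W → Reach G (avoiding W) w v → w ≡ v
  avoiding-isolates W w∈W here = refl
  avoiding-isolates W w∈W (step e e∈ j _) =
    contradiction (_ , w∈W , _ , j) (∈-select⁻ (¬? ∘ meets? W) e∈)

  -- Without the edges that meet `W`, each vertex of `W` is a tree component by itself. This is how
  -- hypotheses on τ become Hall conditions.
  ∣W∣≤τ[avoiding] : ∀ W {k} → Tau G (avoiding W) k → ∣ W ∣ ≤ k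
  ∣W∣≤τ[avoiding] W {k} (r , tree , apart , cover) = subst (∣ W ∣ ≤_) (∣⊤∣≡n k)
    (∣∣-inj-≤ W (⊤ {k}) (λ w i → w ∈ W × Reach G (avoiding W) (r i) w)
      (λ w∈W → let i , p = cover _ (isolated-tree w∈W) in i , ∈⊤ , w∈W , p)
      (λ { (w∈W , p) (_ , p') → avoiding-isolates W w∈W (reach-trans (reach-sym p) p') }))
    where
    isolated-tree : ∀ {w} → w ∈ W → TreeComp G (avoiding W) w
    isolated-tree w∈W (c , p) = contradiction
      (_ , subst (_∈ W) (avoiding-isolates W w∈W p) w∈W , _ , es-join c zero)
      (∈-select⁻ (¬? ∘ meets? W) (es-in c zero))

  -- Systems of distinct incident edges

  -- An edge set is a base of the bicircular matroid exactly when it is the image of such a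
  -- system: orient every edge away from the vertex it represents.
  record System : Set where
    field
      rep : Vertex → Edge
      rep-inj : ∀ {u v} → rep u ≡ rep v → u ≡ v
      rep-inc : ∀ v → Inc (rep v) v

    succ : Vertex → Vertex
    succ v = proj₁ (rep-inc v)

    rep-joins : ∀ v → Joins G (rep v) v (succ v)
    rep-joins v = proj₂ (rep-inc v)

    orbit : ℕ → Vertex → Vertex
    orbit zero v = v
    orbit (suc k) v = succ (orbit k v)

    orbit-succ : ∀ k v → orbit k (succ v) ≡ succ (orbit k v)
    orbit-succ zero v = refl
    orbit-succ (suc k) v = cong succ (orbit-succ k v)

    module Escape (F : ESet G) (r : Vertex) where

      Escapes : Set
      Escapes = ∃ λ v → Reach G F r v × rep v ∉ F

      InjectiveUpTo StaysBefore : ℕ → Set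
      InjectiveUpTo p = ∀ {i j} → i ≤ p → j ≤ p → orbit i r ≡ orbit j r → i ≡ j
      StaysBefore p = ∀ {i} → i < p → rep (orbit i r) ∈ F

      stays-suc : ∀ {p} → StaysBefore p → rep (orbit p r) ∈ F → StaysBefore (suc p)
      stays-suc stays ∈F (s≤s i≤p) with ℕ.m≤n⇒m<n∨m≡n i≤p
      ... | inj₁ i<p = stays i<p
      ... | inj₂ refl = ∈F

      reach-orbit : ∀ {p} → StaysBefore p → ∀ {i} → i ≤ p → Reach G F r (orbit i r)
      reach-orbit stays {zero} _ = here
      reach-orbit stays {suc i} i<p = reach-trans (reach-orbit stays (<⇒≤ i<p))
        (step _ (stays i<p) (rep-joins _) here)

      -- The cycle runs from `orbit a r` to `orbit p r`, so `len` is `p ∸ a`, one less than the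
      -- number of its vertices. Its edges are distinct because `rep` is injective.
      close-cycle : ∀ {p a} → a ≤ p → orbit a r ≡ orbit (suc p) r → InjectiveUpTo p → StaysBefore (suc p) →
        HasCycleAt F r
      close-cycle {p} {a} a≤p wraps inj stays = record
        { len = p ∸ a ; vs = vs' ; es = rep ∘ vs' ; vs-inj = vs'-inj ; es-inj = vs'-inj ∘ rep-inj
        ; es-in = λ i → stays (s≤s (bound i))
        ; es-join = λ i → subst (Joins G _ (vs' i)) (closes i) (rep-joins (vs' i)) }
        , reach-orbit stays (≤-trans a≤p (ℕ.n≤1+n p))
        where
        vs' : Fin (suc (p ∸ a)) → Vertex
        vs' i = orbit (toℕ i + a) r
        bound : ∀ (i : Fin (suc (p ∸ a))) → toℕ i + a ≤ p
        bound i = subst (toℕ i + a ≤_) (ℕ.m∸n+n≡m a≤p) (ℕ.+-monoˡ-≤ a (ℕ.≤-pred (toℕ<n i)))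
        vs'-inj : ∀ {i j} → vs' i ≡ vs' j → i ≡ j
        vs'-inj {i} {j} eq = toℕ-injective (ℕ.+-cancelʳ-≡ a (toℕ i) (toℕ j) (inj (bound i) (bound j) eq))
        closes : ∀ i → succ (vs' i) ≡ vs' (cnext i)
        closes i with suc (toℕ i) ℕ.<? suc (p ∸ a)
        ... | yes lt = cong (λ k → orbit (k + a) r) (sym (trans (toℕ-cnext i) (m<n⇒m%n≡m lt)))
        ... | no ≮ = trans (cong (λ k → orbit (suc k) r) last)
            (trans (sym wraps) (cong (λ k → orbit (k + a) r) (sym first)))
          where
          i≡ : toℕ i ≡ p ∸ a
          i≡ = ℕ.≤-antisym (ℕ.≤-pred (toℕ<n i)) (ℕ.≤-pred (ℕ.≮⇒≥ ≮))
          last : toℕ i + a ≡ p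
          last = trans (cong (_+ a) i≡) (ℕ.m∸n+n≡m a≤p)
          first : toℕ (cnext i) ≡ 0
          first = trans (toℕ-cnext i) (trans (cong (λ k → suc k % suc (p ∸ a)) i≡) (n%n≡0 (suc (p ∸ a))))

      -- By the pigeonhole principle the walk along `succ` either uses an edge outside `F` or
      -- revisits a vertex. Applied to the image it yields the cycles of a base; applied at a tree
      -- component it yields an edge of the base outside `F`.
      escape-or-cycle : Escapes ⊎ HasCycleAt F r
      escape-or-cycle = follow (n G) 0 (subst (n G ≤_) (sym (ℕ.+-identityʳ _)) ≤-refl) (λ { z≤n z≤n _ → refl }) (λ ())
        where
        follow : ∀ fuel p → n G ≤ fuel + p → InjectiveUpTo p → StaysBefore p → Escapes ⊎ HasCycleAt F r
        follow zero p n≤p inj stays = contradiction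
          (injective⇒≤ {f = λ (i : Fin (suc p)) → orbit (toℕ i) r}
            λ {i} {j} eq → toℕ-injective (inj (ℕ.≤-pred (toℕ<n i)) (ℕ.≤-pred (toℕ<n j)) eq))
          (ℕ.<⇒≱ (s≤s n≤p))
        follow (suc fuel) p n≤ inj stays with rep (orbit p r) ∈? F
        ... | no ∉F = inj₁ (orbit p r , reach-orbit stays ≤-refl , ∉F)
        ... | yes ∈F with ℕ.anyUpTo? (λ i → orbit i r ≟ orbit (suc p) r) (suc p)
        ... | yes (i , s≤s i≤p , wraps) = inj₂ (close-cycle i≤p wraps inj (stays-suc stays ∈F))
        ... | no ¬wraps = follow fuel (suc p) (subst (n G ≤_) (sym (ℕ.+-suc fuel p)) n≤) inj' (stays-suc stays ∈F)
          where
          inj' : InjectiveUpTo (suc p)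
          inj' i≤ j≤ eq with ℕ.m≤n⇒m<n∨m≡n i≤ | ℕ.m≤n⇒m<n∨m≡n j≤
          ... | inj₁ (s≤s i≤p) | inj₁ (s≤s j≤p) = inj i≤p j≤p eq
          ... | inj₁ i<  | inj₂ refl = contradiction (_ , i< , eq) ¬wraps
          ... | inj₂ refl | inj₁ j< = contradiction (_ , j< , sym eq) ¬wraps
          ... | inj₂ refl | inj₂ refl = refl

    image : ESet G
    image = select (λ e → any? λ v → rep v ≟ e)

    rep∈image : ∀ v → rep v ∈ image
    rep∈image v = ∈-select⁺ (λ e → any? λ v → rep v ≟ e) (v , refl)

    image⁻ : ∀ {e} → e ∈ image → ∃ λ v → rep v ≡ e
    image⁻ = ∈-select⁻ (λ e → any? λ v → rep v ≟ e)

    image-edge : ∀ {e u v} → e ∈ image → Joins G e u v →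
      (rep u ≡ e × succ u ≡ v) ⊎ (rep v ≡ e × succ v ≡ u)
    image-edge e∈ j with image⁻ e∈
    ... | x , refl with joins-unique (rep-joins x) j
    ... | inj₁ (refl , refl) = inj₁ (refl , refl)
    ... | inj₂ (refl , refl) = inj₂ (refl , refl)

    -- Every edge of the image is a step of `succ` from one of its ends, so the orbits of adjacent
    -- vertices merge.
    orbits-meet : ∀ {u v} → Reach G image u v → ∃ λ i → ∃ λ j → orbit i u ≡ orbit j v
    orbits-meet here = 0 , 0 , refl
    orbits-meet (step e e∈ joins p) with orbits-meet p | image-edge e∈ joins
    ... | i , j , eq | inj₁ (_ , refl) = suc i , j , trans (sym (orbit-succ i _)) eq
    ... | i , j , eq | inj₂ (_ , refl) = i , suc j , trans (orbit-succ i _) (cong succ eq)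

    module OnCycle (c : Cycle G image) where

      Fwd Bwd : Fin (suc (len c)) → Set
      Fwd i = rep (vs c i) ≡ es c i × succ (vs c i) ≡ vs c (cnext i)
      Bwd i = rep (vs c (cnext i)) ≡ es c i × succ (vs c (cnext i)) ≡ vs c i

      fwd-or-bwd : ∀ i → Fwd i ⊎ Bwd i
      fwd-or-bwd i = image-edge (es-in c i) (es-join c i)

      bwd-cnext : ∀ i → Bwd i → Bwd (cnext i)
      bwd-cnext i bwd with fwd-or-bwd (cnext i)
      ... | inj₂ bwd' = bwd'
      -- Here `vs c (cnext i)` represents both edges, so they coincide and the cycle is a loop,
      -- where `i` equals `cnext i`.
      ... | inj₁ (eq , _) = subst Bwd (es-inj c (trans (sym (proj₁ bwd)) eq)) bwd

      bwd-advance : ∀ k i → Bwd i → Bwd (advance k i)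
      bwd-advance zero i bwd = bwd
      bwd-advance (suc k) i bwd = bwd-cnext _ (bwd-advance k i bwd)

      -- Two consecutive edges of a cycle cannot represent the same vertex, so the cycle is
      -- traversed by succ in one of its two directions.
      oriented : (∀ i → Fwd i) ⊎ (∀ i → Bwd i)
      oriented with any? (λ i → (rep (vs c (cnext i)) ≟ es c i) ×-dec (succ (vs c (cnext i)) ≟ vs c i))
      ... | yes (i , bwd) = inj₂ λ j → let k , eq = advance-to i j in subst Bwd eq (bwd-advance k i bwd)
      ... | no ¬bwd = inj₁ λ i → [ id , (λ bwd → contradiction (i , bwd) ¬bwd) ]′ (fwd-or-bwd i)

      edge⇒vertex : ∀ i → ∃ λ x → rep (vs c x) ≡ es c i
      edge⇒vertex i with oriented
      ... | inj₁ fwd = i , proj₁ (fwd i)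
      ... | inj₂ bwd = cnext i , proj₁ (bwd i)

      vertex⇒edge : ∀ x → ∃ λ i → rep (vs c x) ≡ es c i × ∃ λ y → succ (vs c x) ≡ vs c y
      vertex⇒edge x with oriented
      ... | inj₁ fwd = x , proj₁ (fwd x) , _ , proj₂ (fwd x)
      ... | inj₂ bwd with cnext-surjective x
      ... | i , refl = i , proj₁ (bwd i) , _ , proj₂ (bwd i)

      orbit-stays : ∀ k x → ∃ λ y → orbit k (vs c x) ≡ vs c y
      orbit-stays zero x = x , refl
      orbit-stays (suc k) x with orbit-stays k x
      ... | y , eq = let _ , _ , z , eq' = vertex⇒edge y in z , trans (cong succ eq) eq'

      orbit-covers : ∀ x y → ∃ λ k → orbit k (vs c x) ≡ vs c y
      orbit-covers x y with oriented
      ... | inj₁ fwd = let k , eq = advance-to x y in k , trans (go k) (cong (vs c) eq)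
        where
        go : ∀ k → orbit k (vs c x) ≡ vs c (advance k x)
        go zero = refl
        go (suc k) = trans (cong succ (go k)) (proj₂ (fwd _))
      -- `succ` runs against the indices here, so the steps are counted from `y` to `x`.
      ... | inj₂ bwd = let k , eq = advance-to y x in k , trans (cong (orbit k ∘ vs c) (sym eq)) (go k)
        where
        go : ∀ k → orbit k (vs c (advance k y)) ≡ vs c y
        go zero = refl
        go (suc k) = trans (sym (orbit-succ k _)) (trans (cong (orbit k) (proj₂ (bwd _))) (go k))

    -- The orbits of the two starting vertices meet, at a vertex lying on both cycles. From there
    -- the orbit runs through all of `c` but stays on `c'`, so every vertex of `c`, and with it the
    -- edge it represents, lies on `c'`.
    cycle-⊆ : ∀ c c' → Reach G image (vs c zero) (vs c' zero) →
      ∀ e → (∃ λ i → es c i ≡ e) → ∃ λ i → es c' i ≡ e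
    cycle-⊆ c c' p e (i , refl) with orbits-meet p
    ... | k , k' , meet =
      let x , on = OnCycle.orbit-stays c k zero
          x' , on' = OnCycle.orbit-stays c' k' zero
          y , rep-y = OnCycle.edge⇒vertex c i
          l , to-y = OnCycle.orbit-covers c x y
          y' , on'' = OnCycle.orbit-stays c' l x'
          i' , rep-y' , _ = OnCycle.vertex⇒edge c' y'
          vy≡ = trans (sym to-y) (trans (cong (orbit l) (trans (sym on) (trans meet on'))) on'')
      in i' , trans (sym rep-y') (trans (cong rep (sym vy≡)) rep-y)

    -- The walk along `succ` cannot leave the image, so every component has a cycle; `cycle-⊆` in
    -- both directions shows that it is the only one.
    image-unicyclic : Unicyclic G image
    image-unicyclic v with Escape.escape-or-cycle image v
    ... | inj₁ (u , _ , ∉image) = contradiction (rep∈image u) ∉image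
    ... | inj₂ (c , p) = c , p , λ c' p' e →
      cycle-⊆ c c' (reach-trans (reach-sym p) p') e , cycle-⊆ c' c (reach-trans (reach-sym p') p) e

  -- Systems inside edge sets with a cycle in every component

  reach-advance : ∀ {F} (c : Cycle G F) k i → Reach G F (vs c i) (vs c (advance k i))
  reach-advance c zero i = here
  reach-advance c (suc k) i =
    reach-trans (reach-advance c k i) (step _ (es-in c _) (es-join c _) here)

  module FromCycles {B : ESet G} (cycle : ∀ v → HasCycleAt B v) where

    -- `rep` is meaningful only on `D`. By `rep-closed` both ends of a chosen edge lie in `D`, so an
    -- edge with an end outside `D` is never already taken.
    record PartialSystem (D : Subset (n G)) : Set where
      field
        rep : Vertex → Edge
        rep-inj : ∀ {u v} → u ∈ D → v ∈ D → rep u ≡ rep v → u ≡ v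
        rep-in : ∀ {u} → u ∈ D → rep u ∈ B
        rep-closed : ∀ {u} → u ∈ D → ∃ λ w → w ∈ D × Joins G (rep u) u w
    open PartialSystem

    enlarge : ∀ {D} → PartialSystem D → ∀ N (h : Vertex → Edge) → (∀ {u} → u ∈ N → u ∉ D) →
      (∀ {u v} → u ∈ N → v ∈ N → h u ≡ h v → u ≡ v) → (∀ {u} → u ∈ N → h u ∈ B) →
      (∀ {u} → u ∈ N → ∃ λ w → w ∈ D ∪ N × Joins G (h u) u w) → PartialSystem (D ∪ N)
    enlarge {D} S N h fresh h-inj h-in h-closed = record
      { rep = rep' ; rep-inj = inj ; rep-in = in' ; rep-closed = closed }
      where
      rep' : Vertex → Edge
      rep' u with u ∈? N
      ... | yes _ = h u
      ... | no  _ = rep S u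
      cases : ∀ {u} → u ∈ D ∪ N → (u ∈ N × rep' u ≡ h u) ⊎ (u ∈ D × rep' u ≡ rep S u)
      cases {u} u∈ with u ∈? N | x∈p∪q⁻ D N u∈
      ... | yes u∈N | _ = inj₁ (u∈N , refl)
      ... | no _ | inj₁ u∈D = inj₂ (u∈D , refl)
      ... | no u∉N | inj₂ u∈N = contradiction u∈N u∉N
      mixed : ∀ {u v} → u ∈ N → v ∈ D → h u ≢ rep S v
      mixed u∈N v∈D eq with h-closed u∈N | rep-closed S v∈D
      ... | w , _ , j | w' , w'∈D , j' with joins-unique (subst (λ e → Joins G e _ _) eq j) j'
      ... | inj₁ (refl , _) = fresh u∈N v∈D
      ... | inj₂ (refl , _) = fresh u∈N w'∈D
      inj : ∀ {u v} → u ∈ D ∪ N → v ∈ D ∪ N → rep' u ≡ rep' v → u ≡ v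
      inj u∈ v∈ eq with cases u∈ | cases v∈
      ... | inj₁ (u∈N , p) | inj₁ (v∈N , q) = h-inj u∈N v∈N (trans (sym p) (trans eq q))
      ... | inj₁ (u∈N , p) | inj₂ (v∈D , q) = contradiction (trans (sym p) (trans eq q)) (mixed u∈N v∈D)
      ... | inj₂ (u∈D , p) | inj₁ (v∈N , q) = contradiction (trans (sym q) (trans (sym eq) p)) (mixed v∈N u∈D)
      ... | inj₂ (u∈D , p) | inj₂ (v∈D , q) = rep-inj S u∈D v∈D (trans (sym p) (trans eq q))
      in' : ∀ {u} → u ∈ D ∪ N → rep' u ∈ B
      in' u∈ with cases u∈
      ... | inj₁ (u∈N , p) = subst (_∈ B) (sym p) (h-in u∈N)
      ... | inj₂ (u∈D , p) = subst (_∈ B) (sym p) (rep-in S u∈D)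
      closed : ∀ {u} → u ∈ D ∪ N → ∃ λ w → w ∈ D ∪ N × Joins G (rep' u) u w
      closed {u} u∈ with cases u∈
      ... | inj₁ (u∈N , p) = let w , w∈ , j = h-closed u∈N in w , w∈ , subst (λ e → Joins G e u w) (sym p) j
      ... | inj₂ (u∈D , p) = let w , w∈ , j = rep-closed S u∈D in
        w , p⊆p∪q N w∈ , subst (λ e → Joins G e u w) (sym p) j

    add-pendant : ∀ {D} → PartialSystem D → ∀ {e x y} → e ∈ B → Joins G e x y → x ∉ D → y ∈ D →
      PartialSystem (D ∪ ⁅ x ⁆)
    add-pendant S {e} {x} {y} e∈B j x∉D y∈D = enlarge S ⁅ x ⁆ (λ _ → e)
      (λ u∈ u∈D → x∉D (subst (_∈ _) (only u∈) u∈D))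
      (λ u∈ v∈ _ → trans (only u∈) (sym (only v∈)))
      (λ _ → e∈B)
      (λ u∈ → y , p⊆p∪q ⁅ x ⁆ y∈D , subst (λ u → Joins G e u y) (sym (only u∈)) j)
      where
      only : ∀ {u} → u ∈ ⁅ x ⁆ → u ≡ x
      only = x∈⁅y⁆⇒x≡y x

    add-cycle : ∀ {D} → PartialSystem D → (c : Cycle G B) → (∀ i → vs c i ∉ D) →
      ∃ λ N → vs c zero ∈ N × PartialSystem (D ∪ N)
    add-cycle {D} S c off = N , on zero , enlarge S N h
      (λ u∈ u∈D → let i , eq , _ = split u∈ in off i (subst (_∈ D) (sym eq) u∈D))
      (λ u∈ v∈ eq → let i , p , p' = split u∈ ; j , q , q' = split v∈ in
        trans (sym p) (trans (cong (vs c) (es-inj c (trans (sym p') (trans eq q')))) q))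
      (λ u∈ → let i , _ , eq = split u∈ in subst (_∈ B) (sym eq) (es-in c i))
      (λ u∈ → let i , p , q = split u∈ in vs c (cnext i) , q⊆p∪q D N (on (cnext i)) ,
        subst₂ (λ e u → Joins G e u (vs c (cnext i))) (sym q) p (es-join c i))
      where
      on? : ∀ u → Dec (∃ λ i → vs c i ≡ u)
      on? u = any? λ i → vs c i ≟ u
      N = select on?
      on : ∀ i → vs c i ∈ N
      on i = ∈-select⁺ on? (i , refl)
      h : Vertex → Edge
      h u with on? u
      ... | yes (i , _) = es c i
      ... | no _ = rep S u
      split : ∀ {u} → u ∈ N → ∃ λ i → vs c i ≡ u × h u ≡ es c i
      split {u} u∈ with on? u | ∈-select⁻ on? u∈
      ... | yes (i , eq) | _ = i , eq , refl
      ... | no none | found = contradiction found none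

    -- Take a vertex outside `D` and the cycle of its component. If the cycle misses `D`, each of
    -- its vertices takes the edge to the next one. Otherwise a path from the vertex to the cycle's
    -- part in `D` has an edge entering `D`, and the outer end of that edge takes it.
    system : Σ System λ S → ∀ v → System.rep S v ∈ B
    system = saturate PartialSystem next Subset.⊥ empty
      where
      empty : PartialSystem Subset.⊥
      empty = record
        -- A placeholder, since no vertex has been assigned an edge yet.
        { rep = λ v → es (proj₁ (cycle v)) zero
        ; rep-inj = λ u∈ → ⊥-elim (∉⊥ u∈) ; rep-in = λ u∈ → ⊥-elim (∉⊥ u∈)
        ; rep-closed = λ u∈ → ⊥-elim (∉⊥ u∈) }
      next : ∀ D → PartialSystem D →
        (Σ System λ S → ∀ v → System.rep S v ∈ B) ⊎ ∃ λ D' → ∣ D ∣ < ∣ D' ∣ × PartialSystem D'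
      next D S with any? (λ v → ¬? (v ∈? D))
      ... | no none = inj₁ (record
          { rep = rep S ; rep-inj = rep-inj S (all∈ _) (all∈ _)
          ; rep-inc = λ v → let w , _ , j = rep-closed S (all∈ v) in w , j }
          , λ v → rep-in S (all∈ v))
        where
        all∈ : ∀ v → v ∈ D
        all∈ v = decidable-stable (v ∈? D) λ v∉ → none (v , v∉)
      ... | yes (v , v∉D) with cycle v
      ... | c , p with any? (λ i → vs c i ∈? D)
      ... | no off = let N , v₀∈N , S' = add-cycle S c (λ i i∈ → off (i , i∈)) in
        inj₂ (D ∪ N , ∣∣<-∪ D N v₀∈N (λ v₀∈ → off (zero , v₀∈)) , S')
      ... | yes (i , i∈D) =
        let k , eq = advance-to zero i
            q = subst (λ j → Reach G B (vs c zero) (vs c j)) eq (reach-advance c k zero)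
            x , y , e , e∈B , j , x∉D , ¬y∉D =
              crossing-edge (λ u → ¬? (u ∈? D)) (reach-trans p q) v∉D (λ i∉D → i∉D i∈D)
        in inj₂ (D ∪ ⁅ x ⁆ , ∣∣<-∪ D ⁅ x ⁆ (x∈⁅x⁆ x) x∉D ,
                 add-pendant S e∈B j x∉D (decidable-stable (y ∈? D) ¬y∉D))

  -- Each tree component of F must be left by the edge of one of its vertices, as following
  -- the edges inside F would produce a cycle.
  edges-outside : ∀ {B F k} → Unicyclic G B → Tau G F k → Σ (Fin k → Edge) λ ψ →
    (∀ i j → ψ i ≡ ψ j → i ≡ j) × (∀ i → ψ i ∈ B) × (∀ i → ψ i ∉ F)
  edges-outside {B} {F} {k} uni (r , tree , apart , _) =
    (λ i → rep S (exit i)) , inj , (λ i → rep∈B _) , λ i → proj₂ (proj₂ (leave i))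
    where
    open System using (rep; rep-inj)
    sys = FromCycles.system (λ v → let c , p , _ = uni v in c , p)
    S = proj₁ sys
    rep∈B = proj₂ sys
    leave : ∀ i → System.Escape.Escapes S F (r i)
    leave i = [ id , (λ cyc → contradiction cyc (tree i)) ]′ (System.Escape.escape-or-cycle S F (r i))
    exit : Fin k → Vertex
    exit i = proj₁ (leave i)
    inj : ∀ i j → rep S (exit i) ≡ rep S (exit j) → i ≡ j
    inj i j eq = decidable-stable (i ≟ j) λ i≢j → apart i j i≢j
      (reach-trans (proj₁ (proj₂ (leave i)))
        (reach-sym (subst (Reach G F (r j)) (sym (rep-inj S eq)) (proj₁ (proj₂ (leave j))))))

  -- Each base supplies the `k` edges of `edges-outside`, and by disjointness all `t * k` of them
  -- are distinct. Those in `Z` lie there beside `F`; of the others each base has at most one,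
  -- charged to the index of the base in `L`.
  packing-bound : ∀ {t F k} (Fs : Fin t → ESet G) → (∀ i → Unicyclic G (Fs i)) →
    (∀ i j → i ≢ j → Disjoint G (Fs i) (Fs j)) → Tau G F k → ∀ Z (L : Subset t) → F ⊆ Z →
    (∀ i {e} → e ∈ Fs i → e ∉ Z → i ∈ L) →
    (∀ i {e e'} → e ∈ Fs i → e' ∈ Fs i → e ∉ Z → e' ∉ Z → e ≡ e') →
    ∣ F ∣ + t * k ≤ ∣ Z ∣ + ∣ L ∣
  packing-bound {t} {F} {k} Fs uni disj τF Z L F⊆Z labelled unique =
    subst (λ z → ∣ F ∣ + z ≤ ∣ Z ∣ + ∣ L ∣) (∣⊤∣≡n (t * k)) (∣∣-inj-⊎ F (⊤ {t * k}) Z L R total R-inj)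
    where
    out = λ i → edges-outside (uni i) τF
    owner : Fin (t * k) → Fin t
    owner x = proj₁ (remQuot {t} k x)
    index : Fin (t * k) → Fin k
    index x = proj₂ (remQuot {t} k x)
    ψ : Fin (t * k) → Edge
    ψ x = proj₁ (out (owner x)) (index x)
    ψ∈ : ∀ x → ψ x ∈ Fs (owner x)
    ψ∈ x = proj₁ (proj₂ (proj₂ (out (owner x)))) (index x)
    ψ∉F : ∀ x → ψ x ∉ F
    ψ∉F x = proj₂ (proj₂ (proj₂ (out (owner x)))) (index x)
    ψ-inj : ∀ x x' → ψ x ≡ ψ x' → x ≡ x'
    ψ-inj x x' eq = trans (sym (combine-remQuot {t} k x))
      (trans (cong₂ combine same (index-inj same eq)) (combine-remQuot {t} k x'))
      where
      same : owner x ≡ owner x'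
      same = decidable-stable (owner x ≟ owner x') λ differ →
        disj _ _ differ (ψ x) (ψ∈ x) (subst (_∈ Fs (owner x')) (sym eq) (ψ∈ x'))
      index-inj : ∀ {i j p q} → i ≡ j → proj₁ (out i) p ≡ proj₁ (out j) q → p ≡ q
      index-inj {i} refl = proj₁ (proj₂ (out i)) _ _
    R : Edge ⊎ Fin (t * k) → Edge ⊎ Fin t → Set
    R (inj₁ e) (inj₁ e') = e ≡ e' × e ∈ F
    R (inj₁ e) (inj₂ i)  = ⊥
    R (inj₂ x) (inj₁ e') = ψ x ≡ e'
    R (inj₂ x) (inj₂ i)  = owner x ≡ i × ψ x ∉ Z
    total : ∀ x → SumMember F ⊤ x → ∃ λ y → SumMember Z L y × R x y
    total (inj₁ e) e∈F = inj₁ e , F⊆Z e∈F , refl , e∈F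
    total (inj₂ x) _ with ψ x ∈? Z
    ... | yes ∈Z = inj₁ (ψ x) , ∈Z , refl
    ... | no ∉Z = inj₂ (owner x) , labelled _ (ψ∈ x) ∉Z , refl , ∉Z
    R-inj : ∀ x x' y → R x y → R x' y → x ≡ x'
    R-inj (inj₁ _) (inj₁ _) (inj₁ _) (refl , _) (refl , _) = refl
    R-inj (inj₁ _) (inj₂ x') (inj₁ _) (refl , e∈F) refl = contradiction e∈F (ψ∉F x')
    R-inj (inj₂ x) (inj₁ _) (inj₁ _) refl (refl , e∈F) = contradiction e∈F (ψ∉F x)
    R-inj (inj₂ x) (inj₂ x') (inj₁ _) p q = cong inj₂ (ψ-inj x x' (trans p (sym q)))
    R-inj (inj₂ x) (inj₂ x') (inj₂ _) (p , x∉) (q , x'∉) = cong inj₂ (ψ-inj x x'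
      (unique _ (ψ∈ x) (subst (λ i → ψ x' ∈ Fs i) (trans q (sym p)) (ψ∈ x')) x∉ x'∉))

  -- Packing rainbow bases

  -- `θ v i` is the edge representing `v` in base `i`; `θ-inj` expresses both the distinctness of
  -- representatives and the disjointness of bases. `C` holds the colours that must survive all
  -- exchanges.
  record Packing {y t : ℕ} (col : Edge → Fin y) (C : Subset y) : Set where
    field
      θ : Vertex → Fin t → Edge
      θ-inj : ∀ {v w i j} → θ v i ≡ θ w j → v ≡ w × i ≡ j
      θ-inc : ∀ v i → Inc (θ v i) v
      θ-col : ∀ {c} → c ∈ C → ∃ λ v → ∃ λ i → col (θ v i) ≡ c

    Shared : Fin t → Fin t → Set
    Shared i j = ∃ λ u → ∃ λ w → col (θ u i) ≡ col (θ w j)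

    Clean : Vertex → Fin t → Set
    Clean v i = ∀ w → col (θ w i) ≡ col (θ v i) → w ≡ v

    shared? : ∀ i j → Dec (Shared i j)
    shared? i j = any? λ u → any? λ w → col (θ u i) ≟ col (θ w j)

    -- If all bases share a colour with base i, then one such element from every other base and
    -- one of two equally coloured elements of base i can be dropped without losing a colour.
    few-colours : ∀ {v w i} → w ≢ v → col (θ w i) ≡ col (θ v i) → (∀ j → Shared i j) →
      ∣ C ∣ + t ≤ n G * t
    few-colours {v} {w} {i} w≢v same shared = subst₂ (λ p q → ∣ C ∣ + p ≤ q) (∣⊤∣≡n t)
      (trans (ℕ.+-identityʳ _) (∣⊤∣≡n (n G * t))) (∣∣-inj-⊎ C (⊤ {t}) (⊤ {n G * t}) [] R total R-inj)
      where
      spare : Fin t → Vertex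
      spare j with j ≟ i
      ... | yes _ = v
      ... | no _ = proj₁ (proj₂ (shared j))
      spare-i : spare i ≡ v
      spare-i with i ≟ i
      ... | yes _ = refl
      ... | no i≢i = contradiction refl i≢i
      spare-col : ∀ j → ∃ λ u → col (θ u i) ≡ col (θ (spare j) j)
      spare-col j with j ≟ i
      ... | yes refl = v , refl
      ... | no _ = proj₁ (shared j) , proj₂ (proj₂ (shared j))
      colour : Fin (n G * t) → Fin y
      colour s = col (θ (proj₁ (remQuot t s)) (proj₂ (remQuot {n G} t s)))
      colour-combine : ∀ u j → colour (combine u j) ≡ col (θ u j)
      colour-combine u j = cong (λ p → col (θ (proj₁ p) (proj₂ p))) (remQuot-combine u j)
      R : Fin y ⊎ Fin t → Fin (n G * t) ⊎ Fin 0 → Set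
      R (inj₁ c) (inj₁ s) = colour s ≡ c × (∀ j → combine (spare j) j ≢ s)
      R (inj₂ j) (inj₁ s) = combine (spare j) j ≡ s
      in-base : ∀ u → ∃ λ s → colour s ≡ col (θ u i) × (∀ j → combine (spare j) j ≢ s)
      in-base u = let x , x≢v , eq = twin in
        combine x i , trans (colour-combine x i) eq , λ j p →
          let q , r = combine-injective (spare j) j x i p in
          x≢v (trans (sym q) (trans (cong spare r) spare-i))
        where
        -- Base `i` loses only the slot of `v`, and `w` still carries its colour.
        twin : ∃ λ x → x ≢ v × col (θ x i) ≡ col (θ u i)
        twin with u ≟ v
        ... | yes refl = w , w≢v , same
        ... | no u≢v = u , u≢v , refl
      total : ∀ x → SumMember C ⊤ x → ∃ λ s → SumMember ⊤ [] s × R x s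
      total (inj₂ j) _ = inj₁ (combine (spare j) j) , ∈⊤ , refl
      total (inj₁ c) c∈C with θ-col c∈C
      ... | u , j , refl with spare j ≟ u
      ... | no ≢u = inj₁ (combine u j) , ∈⊤ , colour-combine u j , λ j' p →
        let q , r = combine-injective (spare j') j' u j p in ≢u (trans (cong spare (sym r)) q)
      ... | yes refl = let u' , eq = spare-col j ; s , eq' , unused = in-base u' in
        inj₁ s , ∈⊤ , trans eq' eq , unused
      R-inj : ∀ x x' s → R x s → R x' s → x ≡ x'
      R-inj (inj₁ _) (inj₁ _) (inj₁ _) (p , _) (q , _) = cong inj₁ (trans (sym p) q)
      R-inj (inj₁ _) (inj₂ j) (inj₁ _) (_ , unused) p = contradiction p (unused j)
      R-inj (inj₂ j) (inj₁ _) (inj₁ _) p (_ , unused) = contradiction p (unused j)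
      R-inj (inj₂ j) (inj₂ j') (inj₁ _) p q =
        cong inj₂ (combine-injectiveʳ (spare j) j (spare j') j' (trans p (sym q)))

  module _ {y t : ℕ} {col : Edge → Fin y} {C : Subset y} where
    open Packing

    -- When bases `i` and `j` exchange their edges at `v`, each receives there a colour of the
    -- other, which none of its own edges bears. So no new conflict arises.
    swap : (Θ : Packing {t = t} col C) (v : Vertex) {i j : Fin t} → ¬ Shared Θ i j →
      Σ (Packing {t = t} col C) λ Θ' → Clean Θ' v i × (∀ {x k} → Clean Θ x k → Clean Θ' x k)
    swap Θ v {i} {j} ¬shared = Θ' , clean-v , clean
      where
      i≢j : i ≢ j
      i≢j refl = ¬shared (v , v , refl)
      σ : Vertex → Fin t → Fin t
      σ x with x ≟ v
      ... | yes _ = transpose i j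
      ... | no _ = id
      σ⁻ : Vertex → Fin t → Fin t
      σ⁻ x with x ≟ v
      ... | yes _ = transpose j i
      ... | no _ = id
      σ-σ⁻ : ∀ x k → σ x (σ⁻ x k) ≡ k
      σ-σ⁻ x k with x ≟ v
      ... | yes _ = transpose-inverse i j
      ... | no _ = refl
      σ⁻-σ : ∀ x k → σ⁻ x (σ x k) ≡ k
      σ⁻-σ x k with x ≟ v
      ... | yes _ = transpose-inverse j i
      ... | no _ = refl
      σ-elsewhere : ∀ {x} k → x ≢ v → σ x k ≡ k
      σ-elsewhere {x} k x≢v with x ≟ v
      ... | yes x≡v = contradiction x≡v x≢v
      ... | no _ = refl
      σ-i : σ v i ≡ j
      σ-i with v ≟ v
      ... | no v≢v = contradiction refl v≢v
      ... | yes _ rewrite dec-true (i ≟ i) refl = refl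
      σ-j : σ v j ≡ i
      σ-j with v ≟ v
      ... | no v≢v = contradiction refl v≢v
      ... | yes _ rewrite dec-false (j ≟ i) (i≢j ∘ sym) | dec-true (j ≟ j) refl = refl
      σ-other : ∀ x {k} → k ≢ i → k ≢ j → σ x k ≡ k
      σ-other x {k} k≢i k≢j with x ≟ v
      ... | no _ = refl
      ... | yes _ rewrite dec-false (k ≟ i) k≢i | dec-false (k ≟ j) k≢j = refl
      θ' : Vertex → Fin t → Edge
      θ' x k = θ Θ x (σ x k)
      Θ' : Packing {t = t} col C
      Θ' = record
        { θ = θ'
        ; θ-inj = λ {x} {x'} {k} {k'} eq → let p , q = θ-inj Θ eq in
            p , trans (sym (σ⁻-σ x k)) (trans (cong (σ⁻ x) (trans q (cong (λ z → σ z k') (sym p)))) (σ⁻-σ x k'))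
        ; θ-inc = λ x k → θ-inc Θ x (σ x k)
        ; θ-col = λ c∈C → let x , k , eq = θ-col Θ c∈C in
            x , σ⁻ x k , trans (cong (col ∘ θ Θ x) (σ-σ⁻ x k)) eq }
      colour≡ : ∀ x k {l} → σ x k ≡ l → col (θ' x k) ≡ col (θ Θ x l)
      colour≡ x k eq = cong (col ∘ θ Θ x) eq
      clean-v : Clean Θ' v i
      clean-v w eq = split (w ≟ v)
        where
        split : Dec (w ≡ v) → w ≡ v
        split (yes p) = p
        split (no w≢v) = contradiction
          (w , v , trans (sym (colour≡ w i (σ-elsewhere i w≢v))) (trans eq (colour≡ v i σ-i))) ¬shared
      clean : ∀ {x k} → Clean Θ x k → Clean Θ' x k
      clean {x} {k} clean-x w eq = split (w ≟ v) (x ≟ v) (k ≟ i) (k ≟ j)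
        where
        colours : ∀ {p q} → σ w k ≡ p → σ x k ≡ q → col (θ Θ w p) ≡ col (θ Θ x q)
        colours p q = trans (sym (colour≡ w k p)) (trans eq (colour≡ x k q))
        split : Dec (w ≡ v) → Dec (x ≡ v) → Dec (k ≡ i) → Dec (k ≡ j) → w ≡ x
        split (yes p) (yes q) _ _ = trans p (sym q)
        split (no w≢v) (no x≢v) _ _ = clean-x w (colours (σ-elsewhere k w≢v) (σ-elsewhere k x≢v))
        split _ _ (no k≢i) (no k≢j) = clean-x w (colours (σ-other w k≢i k≢j) (σ-other x k≢i k≢j))
        -- From here on one edge is the exchanged one at `v` and the other is not at `v`, so before
        -- the exchange one belonged to base `i` and one to base `j`; equal colours would be shared.
        split (yes refl) (no x≢v) (yes refl) _ =
          contradiction (x , w , sym (colours σ-i (σ-elsewhere k x≢v))) ¬shared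
        split (yes refl) (no x≢v) (no _) (yes refl) =
          contradiction (w , x , colours σ-j (σ-elsewhere k x≢v)) ¬shared
        split (no w≢v) (yes refl) (yes refl) _ =
          contradiction (w , x , colours (σ-elsewhere k w≢v) σ-i) ¬shared
        split (no w≢v) (yes refl) (no _) (yes refl) =
          contradiction (x , w , sym (colours (σ-elsewhere k w≢v) σ-j)) ¬shared

    -- `D` records slots known to be clean, so a conflict occurs at a slot outside `D`. As `many`
    -- contradicts the bound of `few-colours`, some base shares no colour with the conflicting one,
    -- and `swap` cleans the slot.
    clean-packing : n G * t < ∣ C ∣ + t → Packing {t = t} col C →
      Σ (Packing {t = t} col C) λ Θ → ∀ v i → Clean Θ v i
    clean-packing many Θ₀ = saturate P next Subset.⊥ (Θ₀ , λ _ _ s∈ → ⊥-elim (∉⊥ s∈))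
      where
      P : Subset (n G * t) → Set
      P D = Σ (Packing {t = t} col C) λ Θ → ∀ v i → combine v i ∈ D → Clean Θ v i
      next : ∀ D → P D → (Σ (Packing {t = t} col C) λ Θ → ∀ v i → Clean Θ v i) ⊎ ∃ λ D' → ∣ D ∣ < ∣ D' ∣ × P D'
      next D (Θ , clean) with any? (λ v → any? λ i → any? λ w →
        ¬? (w ≟ v) ×-dec (col (θ Θ w i) ≟ col (θ Θ v i)))
      ... | no none = inj₁ (Θ , λ v i w eq → decidable-stable (w ≟ v) λ w≢v → none (v , i , w , w≢v , eq))
      ... | yes (v , i , w , w≢v , same) with any? (λ j → ¬? (shared? Θ i j))
      ... | no none = contradiction
        (few-colours Θ w≢v same λ j → decidable-stable (shared? Θ i j) λ ¬s → none (j , ¬s)) (ℕ.<⇒≱ many)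
      ... | yes (j , ¬shared) = let Θ' , clean-v , clean' = swap Θ v ¬shared in
        inj₂ (D ∪ ⁅ combine v i ⁆
          , ∣∣<-∪ D ⁅ combine v i ⁆ (x∈⁅x⁆ _) (λ vi∈D → w≢v (clean v i vi∈D w same))
          , Θ' , λ x k s∈ → [ clean' ∘ clean x k , (λ s∈vi →
              let p , q = combine-injective x k v i (x∈⁅y⁆⇒x≡y _ s∈vi) in
              subst₂ (Clean Θ') (sym p) (sym q) clean-v) ]′ (x∈p∪q⁻ D ⁅ combine v i ⁆ s∈))

    rainbow-bases : (Θ : Packing {t = t} col C) → (∀ v i → Clean Θ v i) → Σ (Fin t → ESet G) λ Fs →
      (∀ i → Unicyclic G (Fs i) × Rainbow G col (Fs i)) × (∀ i j → i ≢ j → Disjoint G (Fs i) (Fs j))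
    rainbow-bases Θ clean = (λ i → image (base i)) , (λ i → image-unicyclic (base i) , rainbow i) , disjoint
      where
      open System using (image; image⁻; image-unicyclic)
      base : Fin t → System
      base i = record
        { rep = λ v → θ Θ v i ; rep-inj = λ eq → proj₁ (θ-inj Θ eq) ; rep-inc = λ v → θ-inc Θ v i }
      rainbow : ∀ i → Rainbow G col (image (base i))
      rainbow i e e' e∈ e'∈ eq with image⁻ (base i) e∈ | image⁻ (base i) e'∈
      ... | v , refl | w , refl = cong (λ x → θ Θ x i) (clean w i v eq)
      disjoint : ∀ i j → i ≢ j → Disjoint G (image (base i)) (image (base j))
      disjoint i j i≢j e e∈ e∈' with image⁻ (base i) e∈ | image⁻ (base j) e∈'
      ... | v , p | w , q = i≢j (proj₂ (θ-inj Θ (trans p (sym q))))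

  -- The bipartite graphs between edges or colours and t copies of every vertex

  module Slots (t : ℕ) where

    Slot : Set
    Slot = Fin (n G * t)

    vertex : Slot → Vertex
    vertex s = proj₁ (remQuot {n G} t s)

    touched? : (T : Subset (n G * t)) (v : Vertex) → Dec (∃ λ i → combine v i ∈ T)
    touched? T v = any? λ i → combine v i ∈? T

    shadow : Subset (n G * t) → Subset (n G)
    shadow T = select (touched? T)

    ∣T∣≤∣shadow∣*t : ∀ T → ∣ T ∣ ≤ ∣ shadow T ∣ * t
    ∣T∣≤∣shadow∣*t T = subst (∣ T ∣ ≤_) (∣cylinder∣ (shadow T) t) (p⊆q⇒∣p∣≤∣q∣ λ {s} s∈T →
      subst (_∈ cylinder (shadow T) t) (combine-remQuot {n G} t s)
        (∈-cylinder (shadow T) (∈-select⁺ (touched? T)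
          (_ , subst (_∈ T) (sym (combine-remQuot {n G} t s)) s∈T))))

    avoiding-or-adjacent : ∀ T e → e ∈ avoiding (shadow T) ⊎ ∃ λ s → s ∈ T × Inc e (vertex s)
    avoiding-or-adjacent T e with meets? (shadow T) e
    ... | no ¬meets = inj₁ (∈-select⁺ (¬? ∘ meets? (shadow T)) ¬meets)
    ... | yes (v , v∈ , inc) = let i , s∈T = ∈-select⁻ (touched? T) v∈ in
      inj₂ (combine v i , s∈T , subst (Inc e) (sym (cong proj₁ (remQuot-combine v i))) inc)

    module Edges = Hall {n G * t} {m G} (λ s e → Inc e (vertex s)) (λ s e → inc? e (vertex s))

    -- Let `F` consist of the edges avoiding the vertices under `T`. All other edges lie in `N`, and
    -- without deficiency there are at least `t` of them for each tree component of `F`; these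
    -- components are at least as many as the vertices under `T`.
    edges-hall : ¬ HasDeficientSet G t → Edges.HallCondition
    edges-hall ¬deficient T N _ nbr = ≤-trans (∣T∣≤∣shadow∣*t T)
      (≤-trans (ℕ.*-monoˡ-≤ t (∣W∣≤τ[avoiding] (shadow T) τF)) (subst (_≤ ∣ N ∣) (ℕ.*-comm t k) tk≤N))
      where
      F = avoiding (shadow T)
      k = proj₁ (τ F)
      τF = proj₂ (τ F)
      m≤ : m G ≤ ∣ N ∣ + ∣ F ∣
      m≤ = cover-≤ N F id λ e → [ (λ e∈F → inj₂ (e , e∈F , refl)) ,
        (λ { (s , s∈T , inc) → inj₁ (nbr s∈T inc) }) ]′ (avoiding-or-adjacent T e)
      tk≤N : t * k ≤ ∣ N ∣
      tk≤N = ℕ.+-cancelˡ-≤ ∣ F ∣ _ _ (≤-trans (ℕ.≮⇒≥ λ lt → ¬deficient (F , k , τF , lt))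
        (subst (m G ≤_) (ℕ.+-comm ∣ N ∣ ∣ F ∣) m≤))

  -- All but at most d of the slots should receive different colours; d wildcards adjacent to
  -- every slot, added to the y colours, absorb the exceptions.
  module Coloured {y d : ℕ} (col : Edge → Fin y) (onto : ∀ c → ∃ λ e → col e ≡ c)
    (incident : ∀ v → ∃ λ e → Inc e v)
    (many : ∀ F k → Tau G F k → 2 ≤ k → ∣ F ∣ + suc d * (k ∸ 1) < y) where

    open Slots (suc d)

    Adj : Slot → Fin (y + d) → Set
    Adj s r = (∃ λ e → col e ↑ˡ d ≡ r × Inc e (vertex s)) ⊎ (∃ λ j → y ↑ʳ j ≡ r)

    adj? : ∀ s r → Dec (Adj s r)
    adj? s r = any? (λ e → (col e ↑ˡ d ≟ r) ×-dec inc? e (vertex s)) ⊎-dec any? (λ j → y ↑ʳ j ≟ r)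

    module Colours = Hall {n G * suc d} {y + d} Adj adj?

    -- With two or more vertices under `T`, `many` applies to the edges avoiding them: one unit from
    -- its strictness and the `d` wildcards replace the `suc d` missing from its left side. With
    -- fewer, `T` has at most `suc d` slots, and the wildcards and the colour of one incident edge
    -- suffice.
    colours-hall : Colours.HallCondition
    colours-hall T N (s₀ , s₀∈T) nbr with 2 ℕ.≤? ∣ shadow T ∣
    ... | yes 2≤W = ≤-trans (∣T∣≤∣shadow∣*t T) (≤-trans (ℕ.*-monoˡ-≤ (suc d) W≤k) ktd≤N)
      where
      F = avoiding (shadow T)
      k = proj₁ (τ F)
      τF = proj₂ (τ F)
      W≤k = ∣W∣≤τ[avoiding] (shadow T) τF
      covered : ∀ r → r ∈ N ⊎ ∃ λ e → e ∈ F × col e ↑ˡ d ≡ r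
      covered r with splitAt y r in eq
      ... | inj₂ j = inj₁ (nbr s₀∈T (inj₂ (j , splitAt⁻¹-↑ʳ {y} eq)))
      ... | inj₁ c with onto c
      ... | e , refl with avoiding-or-adjacent T e
      ... | inj₁ e∈F = inj₂ (e , e∈F , splitAt⁻¹-↑ˡ eq)
      ... | inj₂ (s , s∈T , inc) = inj₁ (nbr s∈T (inj₁ (e , splitAt⁻¹-↑ˡ eq , inc)))
      y+d≤ : y + d ≤ ∣ N ∣ + ∣ F ∣
      y+d≤ = cover-≤ N F (λ e → col e ↑ˡ d) covered
      split-k : ∀ k → 2 ≤ k → suc d * (k ∸ 1) + suc d ≡ k * suc d
      split-k (suc k) _ = trans (ℕ.+-comm (suc d * k) (suc d)) (cong (suc d +_) (ℕ.*-comm (suc d) k))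
      ktd≤N : k * suc d ≤ ∣ N ∣
      ktd≤N = ℕ.+-cancelˡ-≤ ∣ F ∣ _ _ (begin
        ∣ F ∣ + k * suc d                      ≡⟨ cong (∣ F ∣ +_) (sym (split-k k (≤-trans 2≤W W≤k))) ⟩
        ∣ F ∣ + (suc d * (k ∸ 1) + suc d)      ≡⟨ sym (ℕ.+-assoc ∣ F ∣ _ _) ⟩
        ∣ F ∣ + suc d * (k ∸ 1) + suc d        ≡⟨ ℕ.+-suc _ d ⟩
        suc (∣ F ∣ + suc d * (k ∸ 1)) + d      ≤⟨ ℕ.+-monoˡ-≤ d (many F k τF (≤-trans 2≤W W≤k)) ⟩
        y + d                                  ≤⟨ y+d≤ ⟩
        ∣ N ∣ + ∣ F ∣                          ≡⟨ ℕ.+-comm ∣ N ∣ ∣ F ∣ ⟩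
        ∣ F ∣ + ∣ N ∣                          ∎)
        where open ℕ.≤-Reasoning
    ... | no 2≰W = ≤-trans (∣T∣≤∣shadow∣*t T) (≤-trans
        (subst (∣ shadow T ∣ * suc d ≤_) (ℕ.*-identityˡ (suc d)) (ℕ.*-monoˡ-≤ (suc d) (ℕ.≤-pred (ℕ.≰⇒> 2≰W))))
        (subst (_≤ ∣ N ∣) (∣⊤∣≡n (suc d)) (∣∣-inj-≤ (⊤ {suc d}) N R total (λ {x} {x'} → R-inj x x'))))
      where
      e₀ = proj₁ (incident (vertex s₀))
      label : Fin (suc d) → Fin y ⊎ Fin d
      label zero = inj₁ (col e₀)
      label (suc j) = inj₂ j
      R : Fin (suc d) → Fin (y + d) → Set
      R x r = join y d (label x) ≡ r
      total : ∀ {x} → x ∈ ⊤ → ∃ λ r → r ∈ N × R x r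
      total {zero} _ = _ , nbr s₀∈T (inj₁ (e₀ , refl , proj₂ (incident (vertex s₀)))) , refl
      total {suc j} _ = _ , nbr s₀∈T (inj₂ (j , refl)) , refl
      label-inj : ∀ x x' → label x ≡ label x' → x ≡ x'
      label-inj zero zero _ = refl
      label-inj (suc j) (suc j) refl = refl
      R-inj : ∀ x x' {r} → R x r → R x' r → x ≡ x'
      R-inj x x' p q = label-inj x x' (trans (sym (splitAt-join y d (label x)))
        (trans (cong (splitAt y) (trans p (sym q))) (splitAt-join y d (label x'))))

    empty-matching : Colours.Matching Subset.⊥
    empty-matching = record
      { mate = λ _ → nothing ; mate-inj = λ () ; mate-adj = λ ()
      ; mate-onto = λ r∈ → ⊥-elim (∉⊥ r∈) ; mate-into = λ () }

    colours-matching : Colours.PerfectMatching⊇ Subset.⊥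
    colours-matching = Colours.extend-matching colours-hall empty-matching

    private
      φ = proj₁ colours-matching
      φ-inj = proj₁ (proj₂ colours-matching)
      φ-adj = proj₁ (proj₂ (proj₂ colours-matching))

    used? : ∀ c → Dec (∃ λ s → φ s ≡ c ↑ˡ d)
    used? c = any? λ s → φ s ≟ c ↑ˡ d

    used : Subset y
    used = select used?

    -- At most `d` slots are matched to wildcards; every other slot has a colour to itself.
    many-used : n G * suc d < ∣ used ∣ + suc d
    many-used = subst (n G * suc d <_) (sym (ℕ.+-suc ∣ used ∣ d)) (s≤s (subst₂ _≤_
      (trans (ℕ.+-identityʳ _) (∣⊤∣≡n (n G * suc d))) (cong (∣ used ∣ +_) (∣⊤∣≡n d))
      (∣∣-inj-⊎ (⊤ {n G * suc d}) [] used (⊤ {d}) R total R-inj)))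
      where
      R : Slot ⊎ Fin 0 → Fin y ⊎ Fin d → Set
      R (inj₁ s) r = φ s ≡ join y d r
      total : ∀ x → SumMember ⊤ [] x → ∃ λ r → SumMember used ⊤ r × R x r
      total (inj₁ s) _ with splitAt y (φ s) in eq
      ... | inj₁ c = inj₁ c , ∈-select⁺ used? (s , sym (splitAt⁻¹-↑ˡ eq)) , sym (splitAt⁻¹-↑ˡ eq)
      ... | inj₂ j = inj₂ j , ∈⊤ , sym (splitAt⁻¹-↑ʳ {y} eq)
      R-inj : ∀ x x' r → R x r → R x' r → x ≡ x'
      R-inj (inj₁ s) (inj₁ s') r p q = cong inj₁ (φ-inj (trans p (sym q)))

    edgeOf : ∀ {s r} → Adj s r → Maybe Edge
    edgeOf (inj₁ (e , _)) = just e
    edgeOf (inj₂ _) = nothing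

    edgeOf-just : ∀ {s r e} (p : Adj s r) → edgeOf p ≡ just e → col e ↑ˡ d ≡ r × Inc e (vertex s)
    edgeOf-just (inj₁ (_ , p)) refl = p

    edgeOf-colour : ∀ {s r c} (p : Adj s r) → r ≡ c ↑ˡ d → ∃ λ e → edgeOf p ≡ just e × col e ≡ c
    edgeOf-colour (inj₁ (e , eq , _)) eq' = e , refl , ↑ˡ-injective d _ _ (trans eq eq')
    edgeOf-colour {c = c} (inj₂ (j , eq)) eq' = contradiction
      (trans (sym (splitAt-↑ʳ y d j)) (trans (cong (splitAt y) (trans eq eq')) (splitAt-↑ˡ y c d))) λ ()

    chosen? : ∀ e → Dec (∃ λ s → edgeOf (φ-adj s) ≡ just e)
    chosen? e = any? λ s → ≡-dec _≟_ (edgeOf (φ-adj s)) (just e)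

    chosen : ESet G
    chosen = select chosen?

    -- Different colours force different edges, so the matching into colours becomes one into edges;
    -- slots holding wildcards become free.
    chosen-matching : Edges.Matching chosen
    chosen-matching = record
      { mate = λ s → edgeOf (φ-adj s)
      ; mate-inj = λ {s} {s'} p q → φ-inj
          (trans (sym (proj₁ (edgeOf-just (φ-adj s) p))) (proj₁ (edgeOf-just (φ-adj s') q)))
      ; mate-adj = λ {s} p → proj₂ (edgeOf-just (φ-adj s) p)
      ; mate-onto = ∈-select⁻ chosen?
      ; mate-into = λ {s} p → ∈-select⁺ chosen? (s , p) }

    -- Extending the matching to all slots may move a chosen edge to another slot but never discards
    -- it, so the used colours survive.
    packing : ¬ HasDeficientSet G (suc d) → Packing {t = suc d} col used
    packing ¬deficient with Edges.extend-matching (edges-hall ¬deficient) chosen-matching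
    ... | ξ , ξ-inj , ξ-inc , ξ-onto = record
      { θ = λ v i → ξ (combine v i)
      ; θ-inj = λ {v} {w} {i} {j} eq → combine-injective v i w j (ξ-inj eq)
      ; θ-inc = λ v i → subst (Inc _) (cong proj₁ (remQuot-combine v i)) (ξ-inc (combine v i))
      ; θ-col = colour-kept }
      where
      colour-kept : ∀ {c} → c ∈ used → ∃ λ v → ∃ λ i → col (ξ (combine v i)) ≡ c
      colour-kept c∈ =
        let s , φs≡ = ∈-select⁻ used? c∈
            e , s↦e , col-e = edgeOf-colour (φ-adj s) φs≡
            s' , ξs'≡e = ξ-onto (∈-select⁺ chosen? (s , s↦e))
        in proj₁ (remQuot {n G} (suc d) s') , proj₂ (remQuot {n G} (suc d) s') ,
           trans (cong (col ∘ ξ) (combine-remQuot {n G} (suc d) s')) (trans (cong col ξs'≡e) col-e)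

  -- Upper bound, extremal colourings and existence of the maximum

  incident-edge : Connected G → 2 ≤ n G → ∀ v → ∃ λ e → Inc e v
  incident-edge conn 2≤n v with any? (λ u → ¬? (v ≟ u))
  ... | no none = contradiction
    (injective⇒≤ {m = n G} {n = 1} {f = λ _ → zero} λ {x} {y} _ → trans (sym (only x)) (only y)) (ℕ.<⇒≱ 2≤n)
    where
    only : ∀ u → v ≡ u
    only u = decidable-stable (v ≟ u) λ v≢u → none (u , v≢u)
  ... | yes (u , v≢u) with conn v u
  ... | here = contradiction refl v≢u
  ... | step e _ j _ = e , _ , j

  -- Having more than `x` colours gives the strict inequality that `Coloured` requires, with `d` one
  -- less than the number of bases. It leads to a clean packing and so to the forbidden rainbow
  -- bases.
  upper-bound : ∀ {d x} → Connected G → 2 ≤ n G → ¬ HasDeficientSet G (suc d) → IsMaxFormula G (suc d) x →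
    ∀ y → GoodColoringCount G (suc d) y → y ≤ x
  upper-bound {d} {x} conn 2≤n ¬deficient (_ , max) y (col , surj , none) = ℕ.≮⇒≥ λ x<y →
    let open Coloured {y} {d} col (λ c → let e , eq = surj c in e , eq refl) (incident-edge conn 2≤n)
          (λ F k τF 2≤k → ≤-<-trans (max F k τF 2≤k) x<y)
        Θ , clean = clean-packing many-used (packing ¬deficient)
    in none (rainbow-bases Θ clean)

  colours≤edges : ∀ {t y} → GoodColoringCount G t y → y ≤ m G
  colours≤edges (col , surj , _) = injective⇒≤ {f = λ c → proj₁ (surj c)} λ {c} {c'} eq →
    trans (sym (proj₂ (surj c) refl)) (proj₂ (surj c') eq)

  deficient-colouring : ∀ {t} → HasDeficientSet G t → GoodColoringCount G t (m G)
  deficient-colouring {t} (F , k , τF , lt) = id , (λ e → e , id) , λ { (Fs , good , disj) →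
    contradiction
      (subst (∣ F ∣ + t * k ≤_) (trans (cong₂ _+_ (∣⊤∣≡n (m G)) (∣⊥∣≡0 t)) (ℕ.+-identityʳ _))
        -- With `Z` equal to `⊤` no edge lies outside it, so no base needs an index in `L`.
        (packing-bound Fs (proj₁ ∘ good) disj τF ⊤ Subset.⊥ ⊆⊤
          (λ i _ e∉⊤ → contradiction ∈⊤ e∉⊤) (λ i _ _ e∉⊤ → contradiction ∈⊤ e∉⊤)))
      (ℕ.<⇒≱ lt) }

  -- All edges outside `Z` have the same colour, so a rainbow base contains at most one of them.
  -- Then `packing-bound`, with every index in `L`, would require `Z` to have one more element than
  -- it has.
  singleOut-colouring : ∀ {d F k} → ¬ HasDeficientSet G (suc d) → Tau G F k → 2 ≤ k →
    GoodColoringCount G (suc d) (∣ F ∣ + suc d * (k ∸ 1))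
  singleOut-colouring {d} {F} {suc (suc k)} ¬deficient τF (s≤s (s≤s z≤n)) =
    subst (GoodColoringCount G (suc d)) size (singleOut Z , surj , noPacking)
    where
    -- One less than `suc d * suc k`, because the common colour of the edges outside `Z` counts too.
    extra = k + d * suc k
    enough : ∣ F ∣ + suc d * suc (suc k) ≤ m G
    enough = ℕ.≮⇒≥ λ lt → ¬deficient (F , _ , τF , lt)
    -- Strictness leaves an edge outside `Z` to bear the colour zero.
    room : ∣ F ∣ + extra < m G
    room = ≤-trans (subst (_≤ ∣ F ∣ + suc d * suc (suc k)) (ℕ.+-suc ∣ F ∣ extra)
      (ℕ.+-monoʳ-≤ ∣ F ∣ (ℕ.*-monoʳ-≤ (suc d) (ℕ.n≤1+n (suc k))))) enough
    ext = superset-of-size F extra (<⇒≤ room)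
    Z = proj₁ ext
    F⊆Z = proj₁ (proj₂ ext)
    ∣Z∣≡ = proj₂ (proj₂ ext)
    size : suc ∣ Z ∣ ≡ ∣ F ∣ + suc d * suc k
    size = trans (cong suc ∣Z∣≡) (sym (ℕ.+-suc ∣ F ∣ extra))
    surj : ∀ c → ∃ λ e → ∀ {e'} → e' ≡ e → singleOut Z e' ≡ c
    surj zero = let e , e∉Z = ∣∣<⇒∃∉ Z (subst (_< m G) (sym ∣Z∣≡) room) in e , λ { refl → singleOut-∉ Z e∉Z }
    surj (suc c) = let e , eq = singleOut-onto Z c in e , λ { refl → eq }
    noPacking : ¬ (Σ (Fin (suc d) → ESet G) λ Fs →
         (∀ i → Unicyclic G (Fs i) × Rainbow G (singleOut Z) (Fs i))
       × (∀ i j → i ≢ j → Disjoint G (Fs i) (Fs j)))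
    noPacking (Fs , good , disj) = ℕ.<-irrefl refl (begin-strict
      ∣ Z ∣ + suc d                        <⟨ ≤-refl ⟩
      suc ∣ Z ∣ + suc d                    ≡⟨ cong (_+ suc d) size ⟩
      ∣ F ∣ + suc d * suc k + suc d        ≡⟨ ℕ.+-assoc ∣ F ∣ _ _ ⟩
      ∣ F ∣ + (suc d * suc k + suc d)      ≡⟨ cong (∣ F ∣ +_) (trans (ℕ.+-comm (suc d * suc k) (suc d)) (sym (ℕ.*-suc (suc d) (suc k)))) ⟩
      ∣ F ∣ + suc d * suc (suc k)          ≤⟨ packing-bound Fs (proj₁ ∘ good) disj τF Z ⊤ F⊆Z (λ _ _ _ → ∈⊤) unique ⟩
      ∣ Z ∣ + ∣ ⊤ {suc d} ∣                ≡⟨ cong (∣ Z ∣ +_) (∣⊤∣≡n (suc d)) ⟩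
      ∣ Z ∣ + suc d                        ∎)
      where
      open ℕ.≤-Reasoning
      unique : ∀ i {e e'} → e ∈ Fs i → e' ∈ Fs i → e ∉ Z → e' ∉ Z → e ≡ e'
      unique i e∈ e'∈ e∉Z e'∉Z = proj₂ (good i) _ _ e∈ e'∈ (trans (singleOut-∉ Z e∉Z) (sym (singleOut-∉ Z e'∉Z)))

  maximum : ∀ {t} → 2 ≤ n G → 1 ≤ t → ∃ (IsMaxFormula G t)
  maximum {t} 2≤n 1≤t = value F* , attained , bounded
    where
    value : ESet G → ℕ
    value F with 2 ℕ.≤? proj₁ (τ F)
    ... | yes _ = ∣ F ∣ + t * (proj₁ (τ F) ∸ 1)
    -- This default cannot be the maximum, as `positive` shows, so the maximiser has at least two
    -- tree components.
    ... | no  _ = 0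
    value-≡ : ∀ {F k} → Tau G F k → 2 ≤ k → value F ≡ ∣ F ∣ + t * (k ∸ 1)
    value-≡ {F} {k} τF 2≤k with ℕ.≤-antisym (tau-≤ τF (proj₂ (τ F))) (tau-≤ (proj₂ (τ F)) τF)
    ... | refl with 2 ℕ.≤? proj₁ (τ F)
    ... | yes _ = refl
    ... | no 2≰k = contradiction 2≤k 2≰k
    F* = proj₁ (argmax value)
    bounded : ∀ F k → Tau G F k → 2 ≤ k → ∣ F ∣ + t * (k ∸ 1) ≤ value F*
    bounded F k τF 2≤k = subst (_≤ value F*) (value-≡ τF 2≤k) (proj₂ (argmax value) F)
    -- In `avoiding ⊤` every vertex is isolated, so it has at least two tree components and a
    -- positive value.
    positive : 1 ≤ value F*
    positive = ≤-trans (≤-trans (ℕ.*-mono-≤ 1≤t (ℕ.∸-monoˡ-≤ 1 2≤k)) (ℕ.m≤n+m _ ∣ avoiding ⊤ ∣))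
      (bounded (avoiding ⊤) _ (proj₂ (τ (avoiding ⊤))) 2≤k)
      where
      2≤k : 2 ≤ proj₁ (τ (avoiding ⊤))
      2≤k = ≤-trans 2≤n (subst (_≤ proj₁ (τ (avoiding ⊤))) (∣⊤∣≡n (n G)) (∣W∣≤τ[avoiding] ⊤ (proj₂ (τ (avoiding ⊤)))))
    attained : Σ (ESet G) λ F → ∃ λ k → Tau G F k × 2 ≤ k × value F* ≡ ∣ F ∣ + t * (k ∸ 1)
    attained = F* , proj₁ (τ F*) , proj₂ (τ F*) , 2≤k , value-≡ (proj₂ (τ F*)) 2≤k
      where
      2≤k : 2 ≤ proj₁ (τ F*)
      2≤k with 2 ℕ.≤? proj₁ (τ F*) | positive
      ... | yes 2≤k | _ = 2≤k
      ... | no _ | ()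

theorem14 : (G : Multigraph) (t : ℕ) →
    Connected G → Cycle G ⊤ → 2 ≤ n G → 1 ≤ t →
    (HasDeficientSet G t → IsArBC G t (m G))
    × (¬ HasDeficientSet G t → ∃ λ x → IsMaxFormula G t x × IsArBC G t x)
theorem14 G (suc d) conn _ 2≤n 1≤t =
    (λ deficient → deficient-colouring deficient , λ _ → colours≤edges)
  , λ ¬deficient →
      let x , isMax = maximum 2≤n 1≤t
          (F , k , τF , 2≤k , x≡) , _ = isMax
      in x , isMax
       , subst (GoodColoringCount G (suc d)) (sym x≡) (singleOut-colouring ¬deficient τF 2≤k)
       , upper-bound conn 2≤n ¬deficient isMax
  where open Graph G
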